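{- Let $n>3$ be a positive odd integer. Then \[ \sum_{k=0}^{(n+1)/2}[4k+1]\frac{(q^{ -1};q^2)_k^3\, (q;q^2)_k} {(q^4;q^2)_k^3\, (q^2;q^2)_k}\, q^{6k} \equiv 0 \pmod{\Phi_n(q)^3}. \] Moreover, if $\gcd(n,3)=1$, then this congruence holds modulo $[n]\Phi_n(q)^2$.
   Context: Here $q$ is an indeterminate. For $x$ and a base $p$ (a power of $q$), $(x;p)_k=\prod_{j=0}^{k-1}(1-xp^j)$ for integers $k\ge0$. The $q$-integer is $[j]=1+q+\cdots+q^{j-1}$, and $\Phi_n(q)$ is the $n$-th cyclotomic polynomial. For rational functions $A(q),B(q)$ and a polynomial $P(q)$, $A\equiv B\pmod{P}$ means that the numerator of the reduced form of $A-B$ is divisible by $P$ in $\mathbb{Z}[q]$. -}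

module Defs where

open import Data.Nat as ℕ using (ℕ; zero; suc; _∸_; _<ᵇ_)
open import Data.Nat.Divisibility using (_∣?_)
open import Data.Integer as ℤ using (ℤ; 0ℤ; 1ℤ)
open import Data.List using (List; []; _∷_; _++_; reverse; dropWhile; length; replicate; map)
open import Data.Bool using (if_then_else_)
open import Data.Product using (∃; _×_)
open import Relation.Nullary using (¬_; does)
open import Relation.Binary.PropositionalEquality using (_≡_)
open import Function using (id)

-- Polynomials in ℤ[q]: coefficient lists, constant term first.

Poly : Set
Poly = List ℤ

normalize : Poly → Poly
normalize p = reverse (dropWhile (ℤ._≟ 0ℤ) (reverse p))

infixl 6 _+ₚ_ _-ₚ_
infixl 7 _*ₚ_

_+ₚ_ : Poly → Poly → Poly
[] +ₚ r = r
(a ∷ p) +ₚ [] = a ∷ p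
(a ∷ p) +ₚ (b ∷ r) = (a ℤ.+ b) ∷ (p +ₚ r)

-ₚ_ : Poly → Poly
-ₚ p = map ℤ.-_ p

_-ₚ_ : Poly → Poly → Poly
p -ₚ r = p +ₚ (-ₚ r)

scaleₚ : ℤ → Poly → Poly
scaleₚ c p = map (c ℤ.*_) p

_*ₚ_ : Poly → Poly → Poly
[] *ₚ r = []
(a ∷ p) *ₚ r = scaleₚ a r +ₚ (0ℤ ∷ (p *ₚ r))

oneₚ : Poly
oneₚ = 1ℤ ∷ []

qₚ : Poly
qₚ = 0ℤ ∷ 1ℤ ∷ []

_^ₚ_ : Poly → ℕ → Poly
p ^ₚ zero = oneₚ
p ^ₚ suc k = p *ₚ (p ^ₚ k)

monomial : ℤ → ℕ → Poly
monomial c s = replicate s 0ℤ ++ (c ∷ [])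

qint : ℕ → Poly
qint j = replicate j 1ℤ

_≈ₚ_ : Poly → Poly → Set
p ≈ₚ r = normalize (p -ₚ r) ≡ []

_∣ₚ_ : Poly → Poly → Set
P ∣ₚ N = ∃ λ M → (M *ₚ P) ≈ₚ N

IsConstant : Poly → Set
IsConstant p = length (normalize p) ℕ.≤ 1

CoprimeP : Poly → Poly → Set
CoprimeP N D = ∀ G → G ∣ₚ N → G ∣ₚ D → IsConstant G

lastOr : {A : Set} → A → List A → A
lastOr d [] = d
lastOr d (x ∷ []) = x
lastOr d (x ∷ y ∷ xs) = lastOr d (y ∷ xs)

divMonic : Poly → Poly → Poly
divMonic a b = go (length a) a []
  where
  b' = normalize b
  lb = length b'
  go : ℕ → Poly → Poly → Poly
  go zero r qt = qt
  go (suc f) r qt =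
    let r' = normalize r in
    if length r' <ᵇ lb then qt
    else (let c = lastOr 0ℤ r'
              s = length r' ∸ lb
          in go f (r' -ₚ (monomial c s *ₚ b')) (qt +ₚ monomial c s))

-- Cyclotomic polynomials, via q^m - 1 = ∏_{d ∣ m} Φ_d.

prodDiv : ℕ → ℕ → List Poly → Poly
prodDiv m i [] = oneₚ
prodDiv m i (p ∷ ps) = (if does (i ∣? m) then (p *ₚ_) else id) (prodDiv m (suc i) ps)

cycList : ℕ → List Poly
cycList zero = []
cycList (suc n) =
  cycList n ++ (divMonic ((qₚ ^ₚ suc n) -ₚ oneₚ) (prodDiv (suc n) 1 (cycList n)) ∷ [])

Φ : ℕ → Poly
Φ n = lastOr oneₚ (cycList n)

-- Rational functions in q as (unreduced) fractions of polynomials.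

record Frac : Set where
  constructor frac
  field
    num : Poly
    den : Poly
open Frac public

fpoly : Poly → Frac
fpoly p = frac p oneₚ

fone fzero : Frac
fone = fpoly oneₚ
fzero = fpoly []

fadd fsub fmul fdiv : Frac → Frac → Frac
fadd (frac a b) (frac c d) = frac ((a *ₚ d) +ₚ (c *ₚ b)) (b *ₚ d)
fsub (frac a b) (frac c d) = frac ((a *ₚ d) -ₚ (c *ₚ b)) (b *ₚ d)
fmul (frac a b) (frac c d) = frac (a *ₚ c) (b *ₚ d)
fdiv (frac a b) (frac c d) = frac (a *ₚ d) (b *ₚ c)

fpow : Frac → ℕ → Frac
fpow x zero = fone
fpow x (suc k) = fmul x (fpow x k)

poch : Frac → Frac → ℕ → Frac
poch x p zero = fone
poch x p (suc k) = fmul (poch x p k) (fsub fone (fmul x (fpow p k)))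

-- A ≡ B (mod P): the numerator of the reduced form of A - B is divisible by P.
-- N/D is "the reduced form" of A - B: D ≠ 0, N and D coprime, N/D = A - B.
_≡_[mod_] : Frac → Frac → Poly → Set
A ≡ B [mod P ] =
  let F = fsub A B in
  ∃ λ N → ∃ λ D → ¬ (D ≈ₚ []) × CoprimeP N D
    × ((N *ₚ den F) ≈ₚ (num F *ₚ D)) × (P ∣ₚ N)

qF qinv : Frac
qF = fpoly qₚ
qinv = frac oneₚ qₚ

cube : Frac → Frac
cube x = fmul x (fmul x x)

term : ℕ → Frac
term k =
  fmul (fpoly (qint (4 ℕ.* k ℕ.+ 1)))
   (fmul (fdiv (fmul (cube (poch qinv (fpoly (qₚ ^ₚ 2)) k)) (poch qF (fpoly (qₚ ^ₚ 2)) k))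
               (fmul (cube (poch (fpoly (qₚ ^ₚ 4)) (fpoly (qₚ ^ₚ 2)) k)) (poch (fpoly (qₚ ^ₚ 2)) (fpoly (qₚ ^ₚ 2)) k)))
         (fpoly (qₚ ^ₚ (6 ℕ.* k))))

sumTerms : ℕ → Frac
sumTerms zero = term 0
sumTerms (suc K) = fadd (sumTerms K) (term (suc K))

{-# OPTIONS --safe #-}
module Submission where

-- The summand is Gosper-summable: the identity `gosper` writes it as a difference, so the partial
-- sums are explicit products. For n = 2m + 1 and K = m + 1, the product formula for the central
-- Gaussian binomial coefficient turns the K-th partial sum into a fraction whose numerator contains
-- (1 - q^n)^4 and whose denominator is composed of q, 1 - q, 1 - q^3, 1 - q^(n+1), 1 - q^(n+3)
-- and 1 + q^j. Modulo q^n - 1 the factors q and 1 + q^j are invertible over ℚ, while 1 - q^(n+1) and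
-- 1 - q^(n+3) become 1 - q and 1 - q^3; these are coprime to Φ n as n > 3, and to [n] if 3 does not
-- divide n. Coprimality is always witnessed by u f + v g = c with c a nonzero integer, which makes
-- it insensitive to the reduction of the fraction.

open import Defs
open import Data.Nat using (ℕ; _<_; _+_; _/_; _%_)
open import Data.Nat.GCD using (gcd)
open import Data.Product using (_×_)
open import Relation.Binary.PropositionalEquality using (_≡_)

open import Algebra.Bundles using (CommutativeRing)
import Algebra.Solver.Ring as RingSolver
open import Algebra.Solver.Ring.AlmostCommutativeRing using (fromCommutativeRing; _-Raw-AlmostCommutative⟶_)
open import Data.Bool using (true; false; if_then_else_; T)
open import Data.Integer as ℤ using (ℤ; 0ℤ; 1ℤ; +_)
import Data.Integer.Properties as ℤP
open import Data.List using ([]; _∷_; _++_; reverse; dropWhile; length)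
open import Data.List.Properties using (unfold-reverse; reverse-++; length-++)
open import Data.Maybe using (just; nothing)
open import Data.Nat as ℕ using (zero; suc; _∸_; _<ᵇ_; z≤n; s≤s)
import Data.Nat.Properties as ℕP
open import Data.Nat.Divisibility as ℕD using (_∣?_)
open import Data.Nat.DivMod using (m≡m%n+[m/n]*n; m*n/n≡m; /-monoˡ-≤)
open import Data.Nat.GCD using (gcd[m,n]∣m; gcd[m,n]∣n; gcd-GCD; module Bézout)
open import Data.Product using (∃; ∃₂; _,_; proj₁; proj₂)
open import Data.Sum using (_⊎_; inj₁; inj₂; [_,_]′)
open import Function using (_∘_; id)
open import Level using (0ℓ)
open import Relation.Binary using (Setoid; IsEquivalence)
open import Relation.Binary.Definitions using (WeaklyDecidable)
open import Relation.Binary.PropositionalEquality as ≡ using (_≢_; refl)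
open import Relation.Nullary using (¬_; Dec; does; yes; no; contradiction)

-- The central Gaussian binomial is what makes composite `n` work: the denominator contains powers
-- of `E₂ m`, whose factors 1 - q^(2j) share cyclotomic factors with [n], so comaximality with [n]
-- fails until `E₂ m` is cancelled against `O m`. Both occur to the fourth power: each of the four
-- Pochhammer symbols above, and each of the four below, reduces to one of them times a few explicit
-- factors. Every symbol above also ends beyond 1 - q^n, whence the exponent 4. The second obstacle
-- is `Φ`, the output of a division loop with bounded fuel: even its divisibility into q^n - 1 has
-- to be proved. The division is exact only if the earlier cyclotomic polynomials are comaximal in
-- pairs, and that follows in turn from the product formula at smaller indices; hence the strong
-- induction `CyclotomicUpTo`. Arguments in ℚ[q] leave integer factors behind. They are removed by
-- division by monic polynomials, or absorbed into both parts of the reduced fraction.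

-- The polynomial ring over ℤ, up to trailing zeros

coeff : Poly → ℕ → ℤ
coeff []      _       = 0ℤ
coeff (a ∷ p) zero    = a
coeff (a ∷ p) (suc i) = coeff p i

infix 4 _≋_

-- Lists with different numbers of trailing zeros denote the same polynomial, so equality is
-- coefficientwise. A record, unlike a bare function type, lets `p` and `r` be inferred from a
-- proof.
record _≋_ (p r : Poly) : Set where
  constructor ⟪_⟫
  field at : ∀ i → coeff p i ≡ coeff r i
open _≋_ public

≋-refl : ∀ {p} → p ≋ p
≋-refl = ⟪ (λ _ → refl) ⟫

≋-sym : ∀ {p r} → p ≋ r → r ≋ p
≋-sym e = ⟪ (λ i → ≡.sym (at e i)) ⟫

≋-trans : ∀ {p r s} → p ≋ r → r ≋ s → p ≋ s
≋-trans e f = ⟪ (λ i → ≡.trans (at e i) (at f i)) ⟫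

≋-isEquivalence : IsEquivalence _≋_
≋-isEquivalence = record { refl = ≋-refl ; sym = ≋-sym ; trans = ≋-trans }

coeff-+ : ∀ p r i → coeff (p +ₚ r) i ≡ coeff p i ℤ.+ coeff r i
coeff-+ []      r       i       = ≡.sym (ℤP.+-identityˡ _)
coeff-+ (a ∷ p) []      i       = ≡.sym (ℤP.+-identityʳ _)
coeff-+ (a ∷ p) (b ∷ r) zero    = refl
coeff-+ (a ∷ p) (b ∷ r) (suc i) = coeff-+ p r i

coeff-- : ∀ p i → coeff (-ₚ p) i ≡ ℤ.- coeff p i
coeff-- []      i       = refl
coeff-- (a ∷ p) zero    = refl
coeff-- (a ∷ p) (suc i) = coeff-- p i

coeff-scale : ∀ c p i → coeff (scaleₚ c p) i ≡ c ℤ.* coeff p i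
coeff-scale c []      i       = ≡.sym (ℤP.*-zeroʳ c)
coeff-scale c (a ∷ p) zero    = refl
coeff-scale c (a ∷ p) (suc i) = coeff-scale c p i

∷-cong : ∀ {a b p r} → a ≡ b → p ≋ r → (a ∷ p) ≋ (b ∷ r)
∷-cong e f = ⟪ (λ { zero → e ; (suc i) → at f i }) ⟫

0∷[]≋[] : (0ℤ ∷ []) ≋ []
0∷[]≋[] = ⟪ (λ { zero → refl ; (suc i) → refl }) ⟫

+-cong : ∀ {p p′ r r′} → p ≋ p′ → r ≋ r′ → (p +ₚ r) ≋ (p′ +ₚ r′)
+-cong {p} {p′} {r} {r′} e f = ⟪ (λ i → ≡.trans (coeff-+ p r i)
  (≡.trans (≡.cong₂ ℤ._+_ (at e i) (at f i)) (≡.sym (coeff-+ p′ r′ i)))) ⟫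

neg-cong : ∀ {p p′} → p ≋ p′ → (-ₚ p) ≋ (-ₚ p′)
neg-cong {p} {p′} e = ⟪ (λ i → ≡.trans (coeff-- p i)
  (≡.trans (≡.cong ℤ.-_ (at e i)) (≡.sym (coeff-- p′ i)))) ⟫

scale-cong : ∀ {c d p r} → c ≡ d → p ≋ r → scaleₚ c p ≋ scaleₚ d r
scale-cong {c} {d} {p} {r} e f = ⟪ (λ i → ≡.trans (coeff-scale c p i)
  (≡.trans (≡.cong₂ ℤ._*_ e (at f i)) (≡.sym (coeff-scale d r i)))) ⟫

+-assoc : ∀ p r s → ((p +ₚ r) +ₚ s) ≋ (p +ₚ (r +ₚ s))
+-assoc p r s = ⟪ (λ i → begin
  coeff ((p +ₚ r) +ₚ s) i                     ≡⟨ coeff-+ (p +ₚ r) s i ⟩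
  coeff (p +ₚ r) i ℤ.+ coeff s i              ≡⟨ ≡.cong (ℤ._+ coeff s i) (coeff-+ p r i) ⟩
  coeff p i ℤ.+ coeff r i ℤ.+ coeff s i       ≡⟨ ℤP.+-assoc (coeff p i) _ _ ⟩
  coeff p i ℤ.+ (coeff r i ℤ.+ coeff s i)     ≡⟨ ≡.cong (ℤ._+_ (coeff p i)) (coeff-+ r s i) ⟨
  coeff p i ℤ.+ coeff (r +ₚ s) i              ≡⟨ coeff-+ p (r +ₚ s) i ⟨
  coeff (p +ₚ (r +ₚ s)) i                     ∎) ⟫
  where open ≡.≡-Reasoning

+-comm : ∀ p r → (p +ₚ r) ≋ (r +ₚ p)
+-comm p r = ⟪ (λ i → ≡.trans (coeff-+ p r i)
  (≡.trans (ℤP.+-comm (coeff p i) (coeff r i)) (≡.sym (coeff-+ r p i)))) ⟫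

+-identityʳ : ∀ p → (p +ₚ []) ≋ p
+-identityʳ p = +-comm p []

+-inverseʳ : ∀ p → (p -ₚ p) ≋ []
+-inverseʳ p = ⟪ (λ i → ≡.trans (coeff-+ p (-ₚ p) i)
  (≡.trans (≡.cong (ℤ._+_ (coeff p i)) (coeff-- p i)) (ℤP.+-inverseʳ (coeff p i)))) ⟫

+-inverseˡ : ∀ p → ((-ₚ p) +ₚ p) ≋ []
+-inverseˡ p = ≋-trans (+-comm (-ₚ p) p) (+-inverseʳ p)

+-setoid : Setoid 0ℓ 0ℓ
+-setoid = record { isEquivalence = ≋-isEquivalence }

import Relation.Binary.Reasoning.Setoid +-setoid as ≋R

+-interchange : ∀ p r s t → ((p +ₚ r) +ₚ (s +ₚ t)) ≋ ((p +ₚ s) +ₚ (r +ₚ t))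
+-interchange p r s t = begin
  (p +ₚ r) +ₚ (s +ₚ t) ≈⟨ +-assoc p r (s +ₚ t) ⟩
  p +ₚ (r +ₚ (s +ₚ t)) ≈⟨ +-cong (≋-refl {p}) (+-assoc r s t) ⟨
  p +ₚ ((r +ₚ s) +ₚ t) ≈⟨ +-cong (≋-refl {p}) (+-cong (+-comm r s) (≋-refl {t})) ⟩
  p +ₚ ((s +ₚ r) +ₚ t) ≈⟨ +-cong (≋-refl {p}) (+-assoc s r t) ⟩
  p +ₚ (s +ₚ (r +ₚ t)) ≈⟨ +-assoc p s (r +ₚ t) ⟨
  (p +ₚ s) +ₚ (r +ₚ t) ∎
  where open ≋R

scale-+ : ∀ c p r → scaleₚ c (p +ₚ r) ≋ (scaleₚ c p +ₚ scaleₚ c r)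
scale-+ c []      r       = ≋-refl
scale-+ c (a ∷ p) []      = ≋-refl
scale-+ c (a ∷ p) (b ∷ r) = ∷-cong (ℤP.*-distribˡ-+ c a b) (scale-+ c p r)

+-scale : ∀ c d p → scaleₚ (c ℤ.+ d) p ≋ (scaleₚ c p +ₚ scaleₚ d p)
+-scale c d []      = ≋-refl
+-scale c d (a ∷ p) = ∷-cong (ℤP.*-distribʳ-+ a c d) (+-scale c d p)

scale-scale : ∀ c d p → scaleₚ c (scaleₚ d p) ≋ scaleₚ (c ℤ.* d) p
scale-scale c d []      = ≋-refl
scale-scale c d (a ∷ p) = ∷-cong (≡.sym (ℤP.*-assoc c d a)) (scale-scale c d p)

scale-1 : ∀ p → scaleₚ 1ℤ p ≋ p
scale-1 []      = ≋-refl
scale-1 (a ∷ p) = ∷-cong (ℤP.*-identityˡ a) (scale-1 p)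

scale-0 : ∀ p → scaleₚ 0ℤ p ≋ []
scale-0 p = ⟪ (λ i → ≡.trans (coeff-scale 0ℤ p i) (ℤP.*-zeroˡ (coeff p i))) ⟫

*-zeroʳ : ∀ p → (p *ₚ []) ≋ []
*-zeroʳ []      = ≋-refl
*-zeroʳ (a ∷ p) = ≋-trans (∷-cong refl (*-zeroʳ p)) 0∷[]≋[]

*-congˡ : ∀ p {r r′} → r ≋ r′ → (p *ₚ r) ≋ (p *ₚ r′)
*-congˡ []      e = ≋-refl
*-congˡ (a ∷ p) e = +-cong (scale-cong {a} refl e) (∷-cong refl (*-congˡ p e))

-- The product recurses on its left factor; this is the matching recursion on the right factor, from
-- which commutativity follows.
*-∷ : ∀ p b r → (p *ₚ (b ∷ r)) ≋ (scaleₚ b p +ₚ (0ℤ ∷ (p *ₚ r)))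
*-∷ []      b r = ≋-sym 0∷[]≋[]
*-∷ (a ∷ p) b r = ∷-cong (≡.cong (ℤ._+ 0ℤ) (ℤP.*-comm a b)) (begin
  scaleₚ a r +ₚ (p *ₚ (b ∷ r))                    ≈⟨ +-cong ≋-refl (*-∷ p b r) ⟩
  scaleₚ a r +ₚ (scaleₚ b p +ₚ (0ℤ ∷ (p *ₚ r)))   ≈⟨ +-assoc (scaleₚ a r) (scaleₚ b p) _ ⟨
  (scaleₚ a r +ₚ scaleₚ b p) +ₚ (0ℤ ∷ (p *ₚ r))   ≈⟨ +-cong (+-comm (scaleₚ a r) (scaleₚ b p)) ≋-refl ⟩
  (scaleₚ b p +ₚ scaleₚ a r) +ₚ (0ℤ ∷ (p *ₚ r))   ≈⟨ +-assoc (scaleₚ b p) (scaleₚ a r) _ ⟩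
  scaleₚ b p +ₚ ((a ∷ p) *ₚ r)                    ∎)
  where open ≋R

*-comm : ∀ p r → (p *ₚ r) ≋ (r *ₚ p)
*-comm p []      = *-zeroʳ p
*-comm p (b ∷ r) = ≋-trans (*-∷ p b r) (+-cong ≋-refl (∷-cong refl (*-comm p r)))

*-cong : ∀ {p p′ r r′} → p ≋ p′ → r ≋ r′ → (p *ₚ r) ≋ (p′ *ₚ r′)
*-cong {p} {p′} {r} {r′} e f = begin
  p *ₚ r    ≈⟨ *-congˡ p f ⟩
  p *ₚ r′   ≈⟨ *-comm p r′ ⟩
  r′ *ₚ p   ≈⟨ *-congˡ r′ e ⟩
  r′ *ₚ p′  ≈⟨ *-comm r′ p′ ⟩
  p′ *ₚ r′  ∎
  where open ≋R

*-distribˡ : ∀ p r s → (p *ₚ (r +ₚ s)) ≋ ((p *ₚ r) +ₚ (p *ₚ s))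
*-distribˡ []      r s = ≋-refl
*-distribˡ (a ∷ p) r s = ≋-trans
  (+-cong (scale-+ a r s) (∷-cong refl (*-distribˡ p r s)))
  (+-interchange (scaleₚ a r) (scaleₚ a s) (0ℤ ∷ (p *ₚ r)) (0ℤ ∷ (p *ₚ s)))

*-distribʳ : ∀ p r s → ((r +ₚ s) *ₚ p) ≋ ((r *ₚ p) +ₚ (s *ₚ p))
*-distribʳ p r s = ≋-trans (*-comm (r +ₚ s) p)
  (≋-trans (*-distribˡ p r s) (+-cong (*-comm p r) (*-comm p s)))

scale-* : ∀ c p r → scaleₚ c (p *ₚ r) ≋ (scaleₚ c p *ₚ r)
scale-* c []      r = ≋-refl
scale-* c (a ∷ p) r = ≋-trans (scale-+ c (scaleₚ a r) (0ℤ ∷ (p *ₚ r)))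
  (+-cong (scale-scale c a r) (∷-cong (ℤP.*-zeroʳ c) (scale-* c p r)))

0∷-* : ∀ p r → ((0ℤ ∷ p) *ₚ r) ≋ (0ℤ ∷ (p *ₚ r))
0∷-* p r = +-cong (scale-0 r) ≋-refl

*-assoc : ∀ p r s → ((p *ₚ r) *ₚ s) ≋ (p *ₚ (r *ₚ s))
*-assoc []      r s = ≋-refl
*-assoc (a ∷ p) r s = begin
  (scaleₚ a r +ₚ (0ℤ ∷ (p *ₚ r))) *ₚ s          ≈⟨ *-distribʳ s (scaleₚ a r) _ ⟩
  (scaleₚ a r *ₚ s) +ₚ ((0ℤ ∷ (p *ₚ r)) *ₚ s)   ≈⟨ +-cong (≋-sym (scale-* a r s)) (≋-trans (0∷-* (p *ₚ r) s) (∷-cong refl (*-assoc p r s))) ⟩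
  (a ∷ p) *ₚ (r *ₚ s)                           ∎
  where open ≋R

*-identityˡ : ∀ p → (oneₚ *ₚ p) ≋ p
*-identityˡ p = ≋-trans (+-cong (scale-1 p) 0∷[]≋[]) (+-identityʳ p)

polyRing : CommutativeRing 0ℓ 0ℓ
polyRing = record
  { Carrier = Poly ; _≈_ = _≋_ ; _+_ = _+ₚ_ ; _*_ = _*ₚ_ ; -_ = -ₚ_ ; 0# = [] ; 1# = oneₚ
  ; isCommutativeRing = record
    { isRing = record
      { +-isAbelianGroup = record
        { isGroup = record
          { isMonoid = record
            { isSemigroup = record
              { isMagma = record { isEquivalence = ≋-isEquivalence ; ∙-cong = +-cong }
              ; assoc = +-assoc }
            ; identity = (λ _ → ≋-refl) , +-identityʳ }
          ; inverse = +-inverseˡ , +-inverseʳ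
          ; ⁻¹-cong = neg-cong }
        ; comm = +-comm }
      ; *-cong = *-cong
      ; *-assoc = *-assoc
      ; *-identity = *-identityˡ , λ p → ≋-trans (*-comm p oneₚ) (*-identityˡ p)
      ; distrib = *-distribˡ , *-distribʳ }
    ; *-comm = *-comm } }

constₚ : ℤ → Poly
constₚ c = c ∷ []

constₚ-homo-* : ∀ a b → constₚ (a ℤ.* b) ≋ (constₚ a *ₚ constₚ b)
constₚ-homo-* a b = ∷-cong (≡.sym (ℤP.+-identityʳ (a ℤ.* b))) ≋-refl

-- The solver takes its coefficients in ℤ, so that numerical coefficients are compared by `coeff≟`
-- and integers can be written with `con`.
ℤ⟶Poly : CommutativeRing.rawRing ℤP.+-*-commutativeRing -Raw-AlmostCommutative⟶ fromCommutativeRing polyRing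
ℤ⟶Poly = record
  { ⟦_⟧    = constₚ
  ; +-homo = λ _ _ → ≋-refl
  ; *-homo = constₚ-homo-*
  ; -‿homo = λ _ → ≋-refl
  ; 0-homo = 0∷[]≋[]
  ; 1-homo = ≋-refl }

coeff≟ : WeaklyDecidable (λ a b → constₚ a ≋ constₚ b)
coeff≟ a b with a ℤ.≟ b
... | yes refl = just ≋-refl
... | no  _    = nothing

module Solver = RingSolver _ _ ℤ⟶Poly coeff≟

open Solver using (Polynomial; solve; _:+_; _:*_; _:-_; :-_; _:^_; con; _:=_)

-- The Horner form of a list, in ring operations that the solver understands.
∷≋ : ∀ a p → (a ∷ p) ≋ (constₚ a +ₚ qₚ *ₚ p)
∷≋ a p = ≋-trans (∷-cong (≡.sym (ℤP.+-identityʳ a)) (≋-sym (*-identityˡ p)))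
  (+-cong (≋-refl {constₚ a}) (≋-sym (0∷-* oneₚ p)))

-- Degrees and the absence of zero divisors

-- The bound is exclusive, so that `Bound p 0` characterises the zero polynomial.
record Bound (p : Poly) (L : ℕ) : Set where
  constructor bounded
  field vanish : ∀ i → L ℕ.≤ i → coeff p i ≡ 0ℤ
open Bound

HasDegree : Poly → ℕ → Set
HasDegree p L = Bound p (suc L) × coeff p L ≢ 0ℤ

bound-mono : ∀ {p L M} → L ℕ.≤ M → Bound p L → Bound p M
bound-mono le b = bounded λ i M≤i → vanish b i (ℕP.≤-trans le M≤i)

bound-≋ : ∀ {p r L} → p ≋ r → Bound p L → Bound r L
bound-≋ e b = bounded λ i le → ≡.trans (≡.sym (at e i)) (vanish b i le)

bound-0 : ∀ {p} → Bound p 0 → p ≋ []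
bound-0 b = ⟪ (λ i → vanish b i z≤n) ⟫

bound-[] : ∀ {L} → Bound [] L
bound-[] = bounded λ _ _ → refl

bound-∷ : ∀ {a p L} → Bound p L → Bound (a ∷ p) (suc L)
bound-∷ b = bounded λ { (suc i) (s≤s le) → vanish b i le }

bound-tail : ∀ {a p L} → Bound (a ∷ p) (suc L) → Bound p L
bound-tail b = bounded λ i le → vanish b (suc i) (s≤s le)

bound-length : ∀ p → Bound p (length p)
bound-length []      = bound-[]
bound-length (a ∷ p) = bound-∷ (bound-length p)

bound-+ : ∀ {p r L} → Bound p L → Bound r L → Bound (p +ₚ r) L
bound-+ {p} {r} b c = bounded λ i le → ≡.trans (coeff-+ p r i) (≡.cong₂ ℤ._+_ (vanish b i le) (vanish c i le))

bound-neg : ∀ {p L} → Bound p L → Bound (-ₚ p) L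
bound-neg {p} b = bounded λ i le → ≡.trans (coeff-- p i) (≡.cong ℤ.-_ (vanish b i le))

bound-- : ∀ {p r L} → Bound p L → Bound r L → Bound (p -ₚ r) L
bound-- b c = bound-+ b (bound-neg c)

bound-scale : ∀ {p L} c → Bound p L → Bound (scaleₚ c p) L
bound-scale {p} c b = bounded λ i le → ≡.trans (coeff-scale c p i)
  (≡.trans (≡.cong (c ℤ.*_) (vanish b i le)) (ℤP.*-zeroʳ c))

bound-pred : ∀ {p L} → Bound p (suc L) → coeff p L ≡ 0ℤ → Bound p L
bound-pred b z = bounded λ i le → [ vanish b i , (λ { refl → z }) ]′ (ℕP.m≤n⇒m<n∨m≡n le)

constₚ-* : ∀ c p → (constₚ c *ₚ p) ≋ scaleₚ c p
constₚ-* c p = ≋-trans (+-cong (≋-refl {scaleₚ c p}) 0∷[]≋[]) (+-identityʳ (scaleₚ c p))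

-- Stated for bounds, with top coefficients that may vanish; `degree-*` and `monic-*` are both read
-- off from it.
coeff-* : ∀ {p r} a b → Bound p (suc a) → Bound r (suc b) →
  Bound (p *ₚ r) (suc (a ℕ.+ b)) × coeff (p *ₚ r) (a ℕ.+ b) ≡ coeff p a ℤ.* coeff r b
coeff-* {[]}    a b _ _ = bound-[] , refl
coeff-* {x ∷ p} {r} zero b bp br =
  bound-≋ (≋-sym xp*r≋) (bound-scale x br) , ≡.trans (at xp*r≋ b) (coeff-scale x r b)
  where
  p≋[] : p ≋ []
  p≋[] = bound-0 (bound-tail bp)
  xp*r≋ : ((x ∷ p) *ₚ r) ≋ scaleₚ x r
  xp*r≋ = ≋-trans (*-cong (∷-cong (refl {x = x}) p≋[]) (≋-refl {r})) (constₚ-* x r)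
coeff-* {x ∷ p} {r} (suc a) b bp br =
  bound-+ {scaleₚ x r} (bound-mono (s≤s (ℕP.m≤n+m b (suc a))) (bound-scale x br)) (bound-∷ (proj₁ ih)) ,
  ≡.trans (coeff-+ (scaleₚ x r) _ (suc (a ℕ.+ b)))
    (≡.trans (≡.cong (ℤ._+ coeff (p *ₚ r) (a ℕ.+ b)) (vanish (bound-scale x br) (suc (a ℕ.+ b)) (s≤s (ℕP.m≤n+m b a))))
      (≡.trans (ℤP.+-identityˡ _) (proj₂ ih)))
  where
  ih = coeff-* {p} {r} a b (bound-tail bp) br

leading : ∀ p → p ≋ [] ⊎ ∃ (HasDegree p)
leading [] = inj₁ ≋-refl
leading (a ∷ p) with leading p
... | inj₂ (L , b , nz) = inj₂ (suc L , bound-∷ b , nz)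
... | inj₁ p≋[] with a ℤ.≟ 0ℤ
...   | yes refl = inj₁ (≋-trans (∷-cong refl p≋[]) 0∷[]≋[])
...   | no a≢0   = inj₂ (0 , bound-∷ (bound-≋ (≋-sym p≋[]) bound-[]) , a≢0)

degree⇒≉0 : ∀ {p L} → HasDegree p L → ¬ p ≋ []
degree⇒≉0 {L = L} (_ , nz) e = nz (at e L)

degree-≋ : ∀ {p r L} → p ≋ r → HasDegree p L → HasDegree r L
degree-≋ {L = L} e (b , nz) = bound-≋ e b , λ z → nz (≡.trans (at e L) z)

degree<bound : ∀ {p L M} → HasDegree p L → Bound p M → L ℕ.< M
degree<bound {L = L} {M} (_ , nz) b with L ℕ.<? M
... | yes lt = lt
... | no ≮   = contradiction (vanish b L (ℕP.≮⇒≥ ≮)) nz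

degree-unique : ∀ {p L M} → HasDegree p L → HasDegree p M → L ≡ M
degree-unique d e = ℕP.≤-antisym (ℕ.s≤s⁻¹ (degree<bound d (proj₁ e))) (ℕ.s≤s⁻¹ (degree<bound e (proj₁ d)))

ℤ-*-≢0 : ∀ {a b} → a ≢ 0ℤ → b ≢ 0ℤ → a ℤ.* b ≢ 0ℤ
ℤ-*-≢0 {a} a≢0 b≢0 e = [ a≢0 , b≢0 ]′ (ℤP.i*j≡0⇒i≡0∨j≡0 a e)

degree-* : ∀ {p r a b} → HasDegree p a → HasDegree r b → HasDegree (p *ₚ r) (a ℕ.+ b)
degree-* {p} {r} {a} {b} (bp , np) (br , nr) =
  proj₁ (coeff-* a b bp br) , λ e → ℤ-*-≢0 np nr (≡.trans (≡.sym (proj₂ (coeff-* a b bp br))) e)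

≉0-* : ∀ {p r} → ¬ p ≋ [] → ¬ r ≋ [] → ¬ (p *ₚ r) ≋ []
≉0-* {p} {r} np nr with leading p | leading r
... | inj₁ e       | _            = contradiction e np
... | inj₂ _       | inj₁ e       = contradiction e nr
... | inj₂ (_ , d) | inj₂ (_ , e) = degree⇒≉0 (degree-* d e)

*≋[]⇒≋[] : ∀ {p r} → ¬ p ≋ [] → (p *ₚ r) ≋ [] → r ≋ []
*≋[]⇒≋[] {p} {r} np e with leading r
... | inj₁ z       = z
... | inj₂ (_ , d) = contradiction e (≉0-* np (degree⇒≉0 d))

-≋[]⇒≋ : ∀ {p r} → (p -ₚ r) ≋ [] → p ≋ r
-≋[]⇒≋ {p} {r} e = begin
  p               ≈⟨ solve 2 (λ p r → p := (p :- r) :+ r) ≋-refl p r ⟩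
  (p -ₚ r) +ₚ r   ≈⟨ +-cong e ≋-refl ⟩
  r               ∎
  where open ≋R

≋⇒-≋[] : ∀ {p r} → p ≋ r → (p -ₚ r) ≋ []
≋⇒-≋[] {p} {r} e = ≋-trans (+-cong e ≋-refl) (+-inverseʳ r)

*-cancelˡ : ∀ f {p r} → ¬ f ≋ [] → (f *ₚ p) ≋ (f *ₚ r) → p ≋ r
*-cancelˡ f {p} {r} nf e = -≋[]⇒≋ (*≋[]⇒≋[] nf (begin
  f *ₚ (p -ₚ r)        ≈⟨ solve 3 (λ f p r → f :* (p :- r) := f :* p :- f :* r) ≋-refl f p r ⟩
  f *ₚ p -ₚ f *ₚ r     ≈⟨ ≋⇒-≋[] e ⟩
  []                   ∎))
  where open ≋R

-- Normal forms

-- `normalize` strips zeros from the reversed list; `trim` recasts it as a recursion from the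
-- constant coefficient, the direction in which lists are taken apart.
trim : ℤ → Poly → Poly
trim a (b ∷ p) = a ∷ b ∷ p
trim a [] with a ℤ.≟ 0ℤ
... | yes _ = []
... | no  _ = a ∷ []

trim-∷ʳ : ∀ a p x → trim a (p ++ x ∷ []) ≡ a ∷ p ++ x ∷ []
trim-∷ʳ a []      x = refl
trim-∷ʳ a (b ∷ p) x = refl

dropWhile-∷ʳ : ∀ l a → reverse (dropWhile (ℤ._≟ 0ℤ) (l ++ a ∷ [])) ≡ trim a (reverse (dropWhile (ℤ._≟ 0ℤ) l))
dropWhile-∷ʳ [] a with a ℤ.≟ 0ℤ
... | yes _ = refl
... | no  _ = refl
dropWhile-∷ʳ (x ∷ l) a with x ℤ.≟ 0ℤ
... | yes _ = dropWhile-∷ʳ l a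
... | no  _ = begin
  reverse (x ∷ l ++ a ∷ [])      ≡⟨ reverse-++ (x ∷ l) (a ∷ []) ⟩
  a ∷ reverse (x ∷ l)            ≡⟨ ≡.cong (a ∷_) (unfold-reverse x l) ⟩
  a ∷ reverse l ++ x ∷ []        ≡⟨ trim-∷ʳ a (reverse l) x ⟨
  trim a (reverse l ++ x ∷ [])   ≡⟨ ≡.cong (trim a) (unfold-reverse x l) ⟨
  trim a (reverse (x ∷ l))       ∎
  where open ≡.≡-Reasoning

normalize-∷ : ∀ a p → normalize (a ∷ p) ≡ trim a (normalize p)
normalize-∷ a p = ≡.trans (≡.cong (reverse ∘ dropWhile (ℤ._≟ 0ℤ)) (unfold-reverse a p)) (dropWhile-∷ʳ (reverse p) a)

trim-≋ : ∀ a p → trim a p ≋ (a ∷ p)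
trim-≋ a (b ∷ p) = ≋-refl
trim-≋ a [] with a ℤ.≟ 0ℤ
... | yes refl = ≋-sym 0∷[]≋[]
... | no  _    = ≋-refl

normalize-≋ : ∀ p → normalize p ≋ p
normalize-≋ []      = ≋-refl
normalize-≋ (a ∷ p) rewrite normalize-∷ a p = ≋-trans (trim-≋ a (normalize p)) (∷-cong refl (normalize-≋ p))

normalize-[] : ∀ {p} → p ≋ [] → normalize p ≡ []
normalize-[] {[]}    e = refl
normalize-[] {a ∷ p} e rewrite normalize-∷ a p | normalize-[] {p} ⟪ at e ∘ suc ⟫ with a ℤ.≟ 0ℤ
... | yes _  = refl
... | no a≢0 = contradiction (at e 0) a≢0

length-normalize : ∀ {p L} → HasDegree p L → length (normalize p) ≡ suc L
length-normalize {[]}    {L}     d = contradiction refl (proj₂ d)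
length-normalize {a ∷ p} {zero}  (b , nz)
  rewrite normalize-∷ a p | normalize-[] {p} (bound-0 (bound-tail b)) with a ℤ.≟ 0ℤ
... | yes a≡0 = contradiction a≡0 nz
... | no _    = refl
length-normalize {a ∷ p} {suc L} (b , nz) rewrite normalize-∷ a p
  with normalize p | length-normalize {p} {L} (bound-tail b , nz)
... | x ∷ l | e = ≡.cong suc e

normalize≡[]⇒≋[] : ∀ {p} → normalize p ≡ [] → p ≋ []
normalize≡[]⇒≋[] {p} e = ≋-trans (≋-sym (normalize-≋ p)) (≡.subst (_≋ []) (≡.sym e) ≋-refl)

≈ₚ⇒≋ : ∀ {p r} → p ≈ₚ r → p ≋ r
≈ₚ⇒≋ e = -≋[]⇒≋ (normalize≡[]⇒≋[] e)

≋⇒≈ₚ : ∀ {p r} → p ≋ r → p ≈ₚ r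
≋⇒≈ₚ e = normalize-[] (≋⇒-≋[] e)

lastOr-coeff : ∀ {L} p → length p ≡ suc L → lastOr 0ℤ p ≡ coeff p L
lastOr-coeff         (a ∷ [])    refl = refl
lastOr-coeff {suc L} (a ∷ b ∷ p) e    = lastOr-coeff (b ∷ p) (ℕP.suc-injective e)

-- Exact division by monic polynomials

Monic : Poly → ℕ → Set
Monic p L = Bound p (suc L) × coeff p L ≡ 1ℤ

1≢0 : 1ℤ ≢ 0ℤ
1≢0 ()

monic⇒degree : ∀ {p L} → Monic p L → HasDegree p L
monic⇒degree (b , e) = b , λ z → 1≢0 (≡.trans (≡.sym e) z)

bound-monomial : ∀ c s → Bound (monomial c s) (suc s)
bound-monomial c zero    = bound-length (c ∷ [])
bound-monomial c (suc s) = bound-∷ (bound-monomial c s)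

coeff-monomial : ∀ c s → coeff (monomial c s) s ≡ c
coeff-monomial c zero    = refl
coeff-monomial c (suc s) = coeff-monomial c s

leadTerm : Poly → Poly → Poly
leadTerm b r = monomial (lastOr 0ℤ (normalize r)) (length (normalize r) ∸ length (normalize b))

reduce : Poly → Poly → Poly
reduce b r = normalize r -ₚ (leadTerm b r *ₚ normalize b)

-- The loop of divMonic is local to Defs; unification against the unfolding of
-- divMonic recovers it as a function of all its arguments.
mutual
  divLoop : ℤ → Poly → Poly → ℕ → Poly → Poly → Poly
  divLoop x xs b = _

  divMonic-loop : ∀ x xs b → (length (normalize (x ∷ xs)) <ᵇ length (normalize b)) ≡ false →
    divMonic (x ∷ xs) b ≡ divLoop x xs b (length xs) (reduce b (x ∷ xs)) (leadTerm b (x ∷ xs))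
  divMonic-loop x xs b eq with length (normalize (x ∷ xs)) <ᵇ length (normalize b) | eq
  ... | false | refl with reduce b (x ∷ xs)
  ... | w with length xs | leadTerm b (x ∷ xs)
  ... | n | v = refl

divLoop-stop : ∀ x xs b f r qt → (length (normalize r) <ᵇ length (normalize b)) ≡ true →
  divLoop x xs b (suc f) r qt ≡ qt
divLoop-stop x xs b f r qt e rewrite e = refl

divLoop-step : ∀ x xs b f r qt → (length (normalize r) <ᵇ length (normalize b)) ≡ false →
  divLoop x xs b (suc f) r qt ≡ divLoop x xs b f (reduce b r) (qt +ₚ leadTerm b r)
divLoop-step x xs b f r qt e rewrite e = refl

<ᵇ-false : ∀ m n → (m ℕ.+ n <ᵇ n) ≡ false
<ᵇ-false m n with m ℕ.+ n <ᵇ n in eq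
... | false = refl
... | true  = contradiction (ℕP.<ᵇ⇒< (m ℕ.+ n) n (≡.subst T (≡.sym eq) _)) (ℕP.≤⇒≯ (ℕP.m≤n+m n m))

module _ {b B} (monic : Monic b B) where

  private
    b-degree : HasDegree b B
    b-degree = monic⇒degree monic

    normalize-b : length (normalize b) ≡ suc B
    normalize-b = length-normalize b-degree

  stop-test : ∀ {r} → r ≋ [] → (length (normalize r) <ᵇ length (normalize b)) ≡ true
  stop-test r≋[] rewrite normalize-[] r≋[] | normalize-b = refl

  step-test : ∀ {r m} → HasDegree r (m ℕ.+ B) → (length (normalize r) <ᵇ length (normalize b)) ≡ false
  step-test {r} {m} d rewrite length-normalize {r} d | normalize-b = <ᵇ-false m B

  reduce-≋ : ∀ {M r} → (M *ₚ b) ≋ r → ((M -ₚ leadTerm b r) *ₚ b) ≋ reduce b r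
  reduce-≋ {M} {r} e = begin
    (M -ₚ l) *ₚ b                           ≈⟨ solve 3 (λ M l b → (M :- l) :* b := M :* b :- l :* b) ≋-refl M l b ⟩
    M *ₚ b -ₚ l *ₚ b                        ≈⟨ +-cong (≋-trans e (≋-sym (normalize-≋ r))) (neg-cong (*-cong (≋-refl {l}) (≋-sym (normalize-≋ b)))) ⟩
    reduce b r                              ∎
    where
    open ≋R
    l = leadTerm b r

  -- As `b` is monic, `leadTerm b r *ₚ normalize b` has the same top coefficient as `r`, and the two
  -- cancel.
  bound-reduce : ∀ {r m} → HasDegree r (m ℕ.+ B) → Bound (reduce b r) (m ℕ.+ B)
  bound-reduce {r} {m} d = bound-pred
    (bound-- (bound-≋ (≋-sym (normalize-≋ r)) (proj₁ d)) (proj₁ product))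
    (≡.trans (coeff-+ (normalize r) _ (m ℕ.+ B))
      (≡.trans (≡.cong₂ ℤ._+_ (at (normalize-≋ r) (m ℕ.+ B)) (≡.trans (coeff-- (l *ₚ normalize b) (m ℕ.+ B)) (≡.cong ℤ.-_ top)))
        (ℤP.+-inverseʳ (coeff r (m ℕ.+ B)))))
    where
    c = lastOr 0ℤ (normalize r)
    l = leadTerm b r
    c≡ : c ≡ coeff r (m ℕ.+ B)
    c≡ = ≡.trans (lastOr-coeff (normalize r) (length-normalize d)) (at (normalize-≋ r) _)
    l≡ : l ≡ monomial c m
    l≡ = ≡.cong (monomial c) (≡.trans (≡.cong₂ _∸_ (length-normalize d) normalize-b) (ℕP.m+n∸n≡m m B))
    product = coeff-* {l} {normalize b} m B (≡.subst (λ l → Bound l (suc m)) (≡.sym l≡) (bound-monomial c m))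
      (bound-≋ (≋-sym (normalize-≋ b)) (proj₁ monic))
    top : coeff (l *ₚ normalize b) (m ℕ.+ B) ≡ coeff r (m ℕ.+ B)
    top = ≡.trans (proj₂ product) (≡.trans (≡.cong₂ ℤ._*_
      (≡.trans (≡.cong (λ l → coeff l m) l≡) (≡.trans (coeff-monomial c m) c≡))
      (≡.trans (at (normalize-≋ b) B) (proj₂ monic))) (ℤP.*-identityʳ _))

  -- The loop invariant: `M` is the part of the quotient still to be found, and the fuel `f` exceeds
  -- the degree of `r`. When the fuel is spent, `r` and therefore `M` are zero.
  divLoop-exact : ∀ x xs f r qt M → (M *ₚ b) ≋ r → Bound r f → divLoop x xs b f r qt ≋ (qt +ₚ M)
  divLoop-exact x xs zero r qt M e bd = ≋-sym (≋-trans (+-cong (≋-refl {qt})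
    (*≋[]⇒≋[] (degree⇒≉0 b-degree) (≋-trans (*-comm b M) (≋-trans e (bound-0 bd))))) (+-identityʳ qt))
  divLoop-exact x xs (suc f) r qt M e bd with leading M
  ... | inj₁ M≋[] = ≡.subst (_≋ (qt +ₚ M)) (≡.sym (divLoop-stop x xs b f r qt (stop-test (≋-trans (≋-sym e) (*-cong M≋[] ≋-refl)))))
        (≋-sym (≋-trans (+-cong (≋-refl {qt}) M≋[]) (+-identityʳ qt)))
  ... | inj₂ (m , dM) = ≡.subst (_≋ (qt +ₚ M)) (≡.sym (divLoop-step x xs b f r qt (step-test dr)))
        (≋-trans (divLoop-exact x xs f (reduce b r) (qt +ₚ l) (M -ₚ l) (reduce-≋ {M} e)
          (bound-mono (ℕ.s≤s⁻¹ (degree<bound dr bd)) (bound-reduce dr)))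
          (solve 3 (λ q l M → (q :+ l) :+ (M :- l) := q :+ M) ≋-refl qt l M))
        where
        l = leadTerm b r
        dr : HasDegree r (m ℕ.+ B)
        dr = degree-≋ e (degree-* dM b-degree)

  -- The first pass is treated apart because `divMonic-loop` identifies the local loop only after
  -- one pass.
  divMonic-exact : ∀ a M → (M *ₚ b) ≋ a → divMonic a b ≋ M
  divMonic-exact [] M e = ≋-sym (*≋[]⇒≋[] (degree⇒≉0 b-degree) (≋-trans (*-comm b M) e))
  divMonic-exact (x ∷ xs) M e with leading M
  ... | inj₁ M≋[] rewrite stop-test (≋-trans (≋-sym e) (*-cong M≋[] (≋-refl {b}))) = ≋-sym M≋[]
  ... | inj₂ (m , dM) = ≡.subst (_≋ M) (≡.sym (divMonic-loop x xs b (step-test dr)))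
        (≋-trans (divLoop-exact x xs (length xs) (reduce b (x ∷ xs)) l (M -ₚ l) (reduce-≋ {M} e)
          (bound-mono (ℕ.s≤s⁻¹ (degree<bound dr (bound-length (x ∷ xs)))) (bound-reduce dr)))
          (solve 2 (λ l M → l :+ (M :- l) := M) ≋-refl l M))
        where
        l = leadTerm b (x ∷ xs)
        dr : HasDegree (x ∷ xs) (m ℕ.+ B)
        dr = degree-≋ e (degree-* dM b-degree)

-- Pseudodivision over ℤ

constₚ-degree : ∀ {c} → c ≢ 0ℤ → HasDegree (constₚ c) 0
constₚ-degree {c} c≢0 = bound-length (constₚ c) , c≢0

constₚ≉0 : ∀ {c} → c ≢ 0ℤ → ¬ constₚ c ≋ []
constₚ≉0 c≢0 = degree⇒≉0 (constₚ-degree c≢0)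

bound-constₚ-* : ∀ {p L} c → Bound p L → Bound (constₚ c *ₚ p) L
bound-constₚ-* {p} c b = bound-≋ (≋-sym (constₚ-* c p)) (bound-scale c b)

-- The leading coefficient of `F` need not be a unit, so every step of the long division multiplies
-- by it once more; `j` counts these steps. The recursion follows the Horner form of `h`.
pseudoDivide : ∀ {F L} → Bound F (suc L) → ∀ h → ∃ λ j → ∃₂ λ t r →
  (constₚ (coeff F L ℤ.^ j) *ₚ h) ≋ (F *ₚ t +ₚ r) × Bound r L
pseudoDivide {F} {L} bF [] = 0 , [] , [] , ≋-sym (≋-trans (+-identityʳ (F *ₚ [])) (≋-trans (*-zeroʳ F) (≋-sym 0∷[]≋[]))) , bound-[]
pseudoDivide {F} {L} bF (a ∷ h) with pseudoDivide bF h
-- `r₁` is the old remainder shifted by one place, with the next coefficient of the dividend. In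
-- degree `L` both `constₚ l *ₚ r₁` and `constₚ x *ₚ F` have coefficient `l ℤ.* x`.
... | j , t , r , e , br = suc j , qₚ *ₚ (constₚ l *ₚ t) +ₚ constₚ x , constₚ l *ₚ r₁ -ₚ constₚ x *ₚ F , eq ,
      bound-pred (bound-- (bound-constₚ-* l br₁) (bound-constₚ-* x bF))
        (≡.trans (coeff-+ (constₚ l *ₚ r₁) (-ₚ (constₚ x *ₚ F)) L) (≡.trans (≡.cong₂ ℤ._+_ (≡.trans (at (constₚ-* l r₁) L) (coeff-scale l r₁ L))
          (≡.trans (coeff-- (constₚ x *ₚ F) L) (≡.cong ℤ.-_ (≡.trans (at (constₚ-* x F) L) (≡.trans (coeff-scale x F L) (ℤP.*-comm x l))))))
          (ℤP.+-inverseʳ (l ℤ.* x))))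
  where
  l = coeff F L
  r₁ = (l ℤ.^ j ℤ.* a) ∷ r
  x = coeff r₁ L
  br₁ : Bound r₁ (suc L)
  br₁ = bound-∷ br
  open ≋R
  eq : (constₚ (l ℤ.* l ℤ.^ j) *ₚ (a ∷ h)) ≋ (F *ₚ (qₚ *ₚ (constₚ l *ₚ t) +ₚ constₚ x) +ₚ (constₚ l *ₚ r₁ -ₚ constₚ x *ₚ F))
  eq = begin
    constₚ (l ℤ.* l ℤ.^ j) *ₚ (a ∷ h)
      ≈⟨ *-cong (constₚ-homo-* l (l ℤ.^ j)) (∷≋ a h) ⟩
    (constₚ l *ₚ constₚ (l ℤ.^ j)) *ₚ (constₚ a +ₚ qₚ *ₚ h)
      ≈⟨ solve 5 (λ l p a q h → (l :* p) :* (a :+ q :* h) := l :* (p :* a) :+ l :* (q :* (p :* h))) ≋-refl (constₚ l) (constₚ (l ℤ.^ j)) (constₚ a) qₚ h ⟩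
    constₚ l *ₚ (constₚ (l ℤ.^ j) *ₚ constₚ a) +ₚ constₚ l *ₚ (qₚ *ₚ (constₚ (l ℤ.^ j) *ₚ h))
      ≈⟨ +-cong (*-congˡ (constₚ l) (≋-sym (constₚ-homo-* (l ℤ.^ j) a))) (*-congˡ (constₚ l) (*-congˡ qₚ e)) ⟩
    constₚ l *ₚ constₚ (l ℤ.^ j ℤ.* a) +ₚ constₚ l *ₚ (qₚ *ₚ (F *ₚ t +ₚ r))
      ≈⟨ solve 7 (λ l p q F t r x → l :* p :+ l :* (q :* (F :* t :+ r)) := F :* (q :* (l :* t) :+ x) :+ (l :* (p :+ q :* r) :- x :* F)) ≋-refl (constₚ l) (constₚ (l ℤ.^ j ℤ.* a)) qₚ F t r (constₚ x) ⟩
    F *ₚ (qₚ *ₚ (constₚ l *ₚ t) +ₚ constₚ x) +ₚ (constₚ l *ₚ (constₚ (l ℤ.^ j ℤ.* a) +ₚ qₚ *ₚ r) -ₚ constₚ x *ₚ F)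
      ≈⟨ +-cong (≋-refl {F *ₚ (qₚ *ₚ (constₚ l *ₚ t) +ₚ constₚ x)}) (+-cong (*-congˡ (constₚ l) (∷≋ (l ℤ.^ j ℤ.* a) r)) (≋-refl { -ₚ (constₚ x *ₚ F)})) ⟨
    F *ₚ (qₚ *ₚ (constₚ l *ₚ t) +ₚ constₚ x) +ₚ (constₚ l *ₚ r₁ -ₚ constₚ x *ₚ F) ∎

^≢0 : ∀ {l} j → l ≢ 0ℤ → l ℤ.^ j ≢ 0ℤ
^≢0 zero    _   = 1≢0
^≢0 (suc j) l≢0 = ℤ-*-≢0 l≢0 (^≢0 j l≢0)

-- Divisibility and comaximality

infix 4 _∣_

_∣_ : Poly → Poly → Set
P ∣ N = ∃ λ M → (M *ₚ P) ≋ N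

-- Comaximality after inverting the nonzero integers, that is, in ℚ[q].
record Comaximal (f g : Poly) : Set where
  constructor comaximal
  field
    {u v}    : Poly
    {c}      : ℤ
    c≢0      : c ≢ 0ℤ
    identity : (u *ₚ f +ₚ v *ₚ g) ≋ constₚ c

comaximal-sym : ∀ {f g} → Comaximal f g → Comaximal g f
comaximal-sym {f} {g} (comaximal {u} {v} c≢0 e) = comaximal {u = v} {u} c≢0 (≋-trans (+-comm (v *ₚ g) (u *ₚ f)) e)

comaximal-*ʳ : ∀ {f g h} → Comaximal f g → Comaximal f h → Comaximal f (g *ₚ h)
comaximal-*ʳ {f} {g} {h} (comaximal {u} {v} {c} c≢0 e) (comaximal {u′} {v′} {d} d≢0 e′) =
  comaximal {u = u *ₚ constₚ d +ₚ v *ₚ g *ₚ u′} {v *ₚ v′} (ℤ-*-≢0 c≢0 d≢0) (begin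
    (u *ₚ constₚ d +ₚ v *ₚ g *ₚ u′) *ₚ f +ₚ v *ₚ v′ *ₚ (g *ₚ h)
      ≈⟨ solve 8 (λ u v u′ v′ d f g h → (u :* d :+ v :* g :* u′) :* f :+ v :* v′ :* (g :* h) := u :* d :* f :+ v :* g :* (u′ :* f :+ v′ :* h)) ≋-refl u v u′ v′ (constₚ d) f g h ⟩
    u *ₚ constₚ d *ₚ f +ₚ v *ₚ g *ₚ (u′ *ₚ f +ₚ v′ *ₚ h)
      ≈⟨ +-cong (≋-refl {u *ₚ constₚ d *ₚ f}) (*-congˡ (v *ₚ g) e′) ⟩
    u *ₚ constₚ d *ₚ f +ₚ v *ₚ g *ₚ constₚ d
      ≈⟨ solve 5 (λ u v d f g → u :* d :* f :+ v :* g :* d := (u :* f :+ v :* g) :* d) ≋-refl u v (constₚ d) f g ⟩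
    (u *ₚ f +ₚ v *ₚ g) *ₚ constₚ d
      ≈⟨ *-cong e ≋-refl ⟩
    constₚ c *ₚ constₚ d
      ≈⟨ constₚ-homo-* c d ⟨
    constₚ (c ℤ.* d) ∎)
  where open ≋R

comaximal-1ʳ : ∀ {f} → Comaximal f oneₚ
comaximal-1ʳ {f} = comaximal {u = []} {oneₚ} 1≢0 (*-identityˡ oneₚ)

comaximal-^ʳ : ∀ {f g} k → Comaximal f g → Comaximal f (g ^ₚ k)
comaximal-^ʳ zero    _ = comaximal-1ʳ
comaximal-^ʳ (suc k) e = comaximal-*ʳ e (comaximal-^ʳ k e)

comaximal-*ˡ : ∀ {f g h} → Comaximal f h → Comaximal g h → Comaximal (f *ₚ g) h
comaximal-*ˡ a b = comaximal-sym (comaximal-*ʳ (comaximal-sym a) (comaximal-sym b))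

comaximal-^ˡ : ∀ {f g} k → Comaximal f g → Comaximal (f ^ₚ k) g
comaximal-^ˡ k e = comaximal-sym (comaximal-^ʳ k (comaximal-sym e))

comaximal-∣ʳ : ∀ {f g h} → g ∣ h → Comaximal f h → Comaximal f g
comaximal-∣ʳ {f} {g} {h} (M , m) (comaximal {u} {v} c≢0 e) = comaximal {u = u} {v *ₚ M} c≢0
  (≋-trans (+-cong (≋-refl {u *ₚ f}) (≋-trans (*-assoc v M g) (*-congˡ v m))) e)

comaximal-∣ˡ : ∀ {f g h} → f ∣ h → Comaximal h g → Comaximal f g
comaximal-∣ˡ d e = comaximal-sym (comaximal-∣ʳ d (comaximal-sym e))

-- Since `g` lies in the ideal of `f` and `h`, comaximality passes from `g` to `h`. Bézout
-- identities and congruences modulo `f` are applied in this form.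
comaximal-combine : ∀ {f g a b h} → (a *ₚ f +ₚ b *ₚ h) ≋ g → Comaximal f g → Comaximal f h
comaximal-combine {f} {g} {a} {b} {h} e (comaximal {u} {v} {c} c≢0 i) = comaximal {u = u +ₚ v *ₚ a} {v *ₚ b} c≢0 (begin
  (u +ₚ v *ₚ a) *ₚ f +ₚ v *ₚ b *ₚ h   ≈⟨ solve 6 (λ u v a b f h → (u :+ v :* a) :* f :+ v :* b :* h := u :* f :+ v :* (a :* f :+ b :* h)) ≋-refl u v a b f h ⟩
  u *ₚ f +ₚ v *ₚ (a *ₚ f +ₚ b *ₚ h)   ≈⟨ +-cong (≋-refl {u *ₚ f}) (*-congˡ v e) ⟩
  u *ₚ f +ₚ v *ₚ g                    ≈⟨ i ⟩
  constₚ c                            ∎)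
  where open ≋R

∣-refl : ∀ {p} → p ∣ p
∣-refl {p} = oneₚ , *-identityˡ p

∣-≋ : ∀ {p r s} → r ≋ s → p ∣ r → p ∣ s
∣-≋ e (M , m) = M , ≋-trans m e

≋-∣ : ∀ {p r s} → p ≋ r → p ∣ s → r ∣ s
≋-∣ e (M , m) = M , ≋-trans (*-congˡ M (≋-sym e)) m

∣-trans : ∀ {p r s} → p ∣ r → r ∣ s → p ∣ s
∣-trans {p} (M , m) (L , l) = L *ₚ M , ≋-trans (*-assoc L M p) (≋-trans (*-congˡ L m) l)

∣-*ˡ : ∀ {p r} s → p ∣ r → p ∣ (s *ₚ r)
∣-*ˡ {p} s (M , m) = s *ₚ M , ≋-trans (*-assoc s M p) (*-congˡ s m)

∣-* : ∀ {p p′ r r′} → p ∣ r → p′ ∣ r′ → (p *ₚ p′) ∣ (r *ₚ r′)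
∣-* {p} {p′} (M , m) (L , l) = M *ₚ L ,
  ≋-trans (solve 4 (λ M L p p′ → M :* L :* (p :* p′) := (M :* p) :* (L :* p′)) ≋-refl M L p p′) (*-cong m l)

degree<⇒≋[] : ∀ {F L s r} → HasDegree F L → (F *ₚ s) ≋ r → Bound r L → s ≋ []
degree<⇒≋[] {F} {L} {s} dF e b with leading s
... | inj₁ z       = z
... | inj₂ (m , d) = contradiction (degree<bound (degree-≋ e (degree-* dF d)) b) (ℕP.≤⇒≯ (ℕP.m≤m+n L m))

1^n≡1 : ∀ n → 1ℤ ℤ.^ n ≡ 1ℤ
1^n≡1 zero    = refl
1^n≡1 (suc n) = ≡.trans (ℤP.*-identityˡ _) (1^n≡1 n)

-- After division of `h` by `F`, the multiple `c r` of the remainder is divisible by `F` but of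
-- smaller degree, hence zero. This removes the integer that `Comaximal` introduces.
monic∣const* : ∀ {F L h c} → Monic F L → c ≢ 0ℤ → F ∣ (constₚ c *ₚ h) → F ∣ h
monic∣const* {F} {L} {h} {c} (bF , lF) c≢0 (s , e) with pseudoDivide bF h
... | j , t , r , div , br = t , ≋-trans (*-comm t F) (≋-sym (≋-trans h≋ (≋-trans (+-cong (≋-refl {F *ₚ t}) r≋[]) (+-identityʳ (F *ₚ t)))))
  where
  open ≋R
  h≋ : h ≋ (F *ₚ t +ₚ r)
  h≋ = ≋-trans (≋-sym (≋-trans (*-cong (∷-cong (≡.trans (≡.cong (ℤ._^ j) lF) (1^n≡1 j)) (≋-refl {[]})) (≋-refl {h})) (*-identityˡ h))) div
  F*≋cr : (F *ₚ (s -ₚ constₚ c *ₚ t)) ≋ (constₚ c *ₚ r)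
  F*≋cr = begin
    F *ₚ (s -ₚ constₚ c *ₚ t)                            ≈⟨ solve 4 (λ F s c t → F :* (s :- c :* t) := s :* F :- c :* (F :* t)) ≋-refl F s (constₚ c) t ⟩
    s *ₚ F -ₚ constₚ c *ₚ (F *ₚ t)                       ≈⟨ +-cong (≋-trans e (*-congˡ (constₚ c) h≋)) ≋-refl ⟩
    constₚ c *ₚ (F *ₚ t +ₚ r) -ₚ constₚ c *ₚ (F *ₚ t)    ≈⟨ solve 3 (λ c x r → c :* (x :+ r) :- c :* x := c :* r) ≋-refl (constₚ c) (F *ₚ t) r ⟩
    constₚ c *ₚ r                                        ∎
  r≋[] : r ≋ []
  r≋[] = *≋[]⇒≋[] (constₚ≉0 c≢0) (≋-trans (≋-sym F*≋cr) (≋-trans (*-congˡ F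
    (degree<⇒≋[] (monic⇒degree (bF , lF)) F*≋cr (bound-constₚ-* c br))) (*-zeroʳ F)))

monic-* : ∀ {p r a b} → Monic p a → Monic r b → Monic (p *ₚ r) (a ℕ.+ b)
monic-* {p} {r} {a} {b} (bp , ep) (br , er) =
  proj₁ (coeff-* a b bp br) , ≡.trans (proj₂ (coeff-* {p} {r} a b bp br)) (≡.cong₂ ℤ._*_ ep er)

-- Multiplying `u f + v g = c` by `h` exhibits `c h` as a multiple of `f g`; monicity then disposes
-- of `c`.
comaximal-*-∣ : ∀ {f g h a b} → Monic f a → Monic g b → Comaximal f g → f ∣ h → g ∣ h → (f *ₚ g) ∣ h
comaximal-*-∣ {f} {g} {h} mf mg (comaximal {u} {v} {c} c≢0 e) (k , kf) (l , lg) =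
  monic∣const* (monic-* mf mg) c≢0 (u *ₚ l +ₚ v *ₚ k , (begin
    (u *ₚ l +ₚ v *ₚ k) *ₚ (f *ₚ g)                     ≈⟨ solve 6 (λ u v k l f g → (u :* l :+ v :* k) :* (f :* g) := u :* f :* (l :* g) :+ v :* g :* (k :* f)) ≋-refl u v k l f g ⟩
    u *ₚ f *ₚ (l *ₚ g) +ₚ v *ₚ g *ₚ (k *ₚ f)           ≈⟨ +-cong (*-congˡ (u *ₚ f) lg) (*-congˡ (v *ₚ g) kf) ⟩
    u *ₚ f *ₚ h +ₚ v *ₚ g *ₚ h                         ≈⟨ *-distribʳ h (u *ₚ f) (v *ₚ g) ⟨
    (u *ₚ f +ₚ v *ₚ g) *ₚ h                            ≈⟨ *-cong e ≋-refl ⟩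
    constₚ c *ₚ h                                      ∎))
  where open ≋R

-- Reduced fractions

∣ₚ⇒∣ : ∀ {p r} → p ∣ₚ r → p ∣ r
∣ₚ⇒∣ (M , e) = M , ≈ₚ⇒≋ e

∣⇒∣ₚ : ∀ {p r} → p ∣ r → p ∣ₚ r
∣⇒∣ₚ (M , e) = M , ≋⇒≈ₚ e

∣constₚ⇒IsConstant : ∀ {G c} → c ≢ 0ℤ → G ∣ constₚ c → IsConstant G
∣constₚ⇒IsConstant {G} c≢0 (M , e) with leading M | leading G
... | _            | inj₁ z rewrite normalize-[] z = z≤n
... | inj₁ z       | _ = contradiction (≋-trans (≋-sym e) (*-cong z (≋-refl {G}))) (constₚ≉0 c≢0)
... | inj₂ (m , d) | inj₂ (g , d′) rewrite length-normalize d′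
  = s≤s (ℕP.≤-trans (ℕP.m≤n+m g m) (ℕP.≤-reflexive (degree-unique (degree-≋ e (degree-* d d′)) (constₚ-degree c≢0))))

comaximal⇒coprime : ∀ {N D} → Comaximal N D → CoprimeP N D
comaximal⇒coprime {N} {D} (comaximal {u} {v} c≢0 e) G G∣N G∣D with ∣ₚ⇒∣ G∣N | ∣ₚ⇒∣ G∣D
... | M , m | L , l = ∣constₚ⇒IsConstant c≢0 (u *ₚ M +ₚ v *ₚ L , (begin
    (u *ₚ M +ₚ v *ₚ L) *ₚ G              ≈⟨ solve 5 (λ u v M L G → (u :* M :+ v :* L) :* G := u :* (M :* G) :+ v :* (L :* G)) ≋-refl u v M L G ⟩
    u *ₚ (M *ₚ G) +ₚ v *ₚ (L *ₚ G)       ≈⟨ +-cong (*-congˡ u m) (*-congˡ v l) ⟩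
    u *ₚ N +ₚ v *ₚ D                     ≈⟨ e ⟩
    constₚ _                             ∎))
  where open ≋R

record Reduced (A B : Poly) : Set where
  field
    {N D}     : Poly
    D≉0       : ¬ D ≋ []
    crossEq   : (N *ₚ B) ≋ (A *ₚ D)
    coprime   : Comaximal N D

-- The continued fraction expansion of A / B, evaluated from its last term.
reduceFraction : ∀ {L} A B → Bound B L → ¬ B ≋ [] → Reduced A B
reduceFraction {zero}  A B bB nz = contradiction (bound-0 bB) nz
reduceFraction {suc L} A B bB nz with leading B
... | inj₁ z = contradiction z nz
... | inj₂ (d , dB , lB) with pseudoDivide dB A
...   | j , t , R , e , bR with leading R
...     | inj₁ R≋[] = record
  { N = t ; D = constₚ l
  ; D≉0 = constₚ≉0 l≢0
  ; crossEq = begin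
      t *ₚ B             ≈⟨ *-comm t B ⟩
      B *ₚ t             ≈⟨ +-identityʳ (B *ₚ t) ⟨
      B *ₚ t +ₚ []       ≈⟨ +-cong (≋-refl {B *ₚ t}) R≋[] ⟨
      B *ₚ t +ₚ R        ≈⟨ e ⟨
      constₚ l *ₚ A      ≈⟨ *-comm (constₚ l) A ⟩
      A *ₚ constₚ l      ∎
  ; coprime = comaximal {u = []} {oneₚ} l≢0 (*-identityˡ (constₚ l)) }
  where
  open ≋R
  l = coeff B d ℤ.^ j
  l≢0 : l ≢ 0ℤ
  l≢0 = ^≢0 j lB
...     | inj₂ (_ , dR) = record
  -- With `l A = B t + R`, the reduced form N/D of B/R gives A/B = (t + D/N)/l.
  { N = t *ₚ N +ₚ D ; D = constₚ l *ₚ N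
  ; D≉0 = ≉0-* (constₚ≉0 l≢0) N≉0
  ; crossEq = begin
      (t *ₚ N +ₚ D) *ₚ B                 ≈⟨ solve 4 (λ t N D B → (t :* N :+ D) :* B := t :* N :* B :+ B :* D) ≋-refl t N D B ⟩
      t *ₚ N *ₚ B +ₚ B *ₚ D              ≈⟨ +-cong (≋-refl {t *ₚ N *ₚ B}) crossEq ⟨
      t *ₚ N *ₚ B +ₚ N *ₚ R              ≈⟨ solve 4 (λ t N R B → t :* N :* B :+ N :* R := N :* (B :* t :+ R)) ≋-refl t N R B ⟩
      N *ₚ (B *ₚ t +ₚ R)                 ≈⟨ *-congˡ N e ⟨
      N *ₚ (constₚ l *ₚ A)               ≈⟨ solve 3 (λ N l A → N :* (l :* A) := A :* (l :* N)) ≋-refl N (constₚ l) A ⟩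
      A *ₚ (constₚ l *ₚ N)               ∎
  ; coprime = comaximal {u = constₚ l *ₚ v} {u -ₚ v *ₚ t} (ℤ-*-≢0 l≢0 c≢0) (begin
      constₚ l *ₚ v *ₚ (t *ₚ N +ₚ D) +ₚ (u -ₚ v *ₚ t) *ₚ (constₚ l *ₚ N)
        ≈⟨ solve 6 (λ l u v t N D → l :* v :* (t :* N :+ D) :+ (u :- v :* t) :* (l :* N) := l :* (u :* N :+ v :* D)) ≋-refl (constₚ l) u v t N D ⟩
      constₚ l *ₚ (u *ₚ N +ₚ v *ₚ D)
        ≈⟨ *-congˡ (constₚ l) identity ⟩
      constₚ l *ₚ constₚ c
        ≈⟨ constₚ-homo-* l c ⟨
      constₚ (l ℤ.* c) ∎) }
  where
  open ≋R
  open Reduced (reduceFraction {L} B R (bound-mono (ℕ.s≤s⁻¹ (degree<bound (dB , lB) bB)) bR) (degree⇒≉0 dR))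
  open Comaximal coprime
  l = coeff B d ℤ.^ j
  l≢0 : l ≢ 0ℤ
  l≢0 = ^≢0 j lB
  N≉0 : ¬ N ≋ []
  N≉0 N≋[] = ≉0-* nz D≉0 (≋-trans (≋-sym crossEq) (*-cong N≋[] (≋-refl {R})))

infix 4 _≃_/_

-- Cross-multiplication alone; nonvanishing of denominators is proved separately and supplied where
-- a common factor is cancelled.
record _≃_/_ (F : Frac) (a b : Poly) : Set where
  constructor cross
  field crossed : (num F *ₚ b) ≋ (a *ₚ den F)
open _≃_/_ public

-- Let N/D be the reduced form, so that `N B = A D`. Multiplying `u₀ P + v₀ B = e` by `N` gives
-- `e N = u₀ P N + v₀ A D`, and `P` divides both summands.
≡0[mod] : ∀ {F A B P} → ¬ den F ≋ [] → F ≃ A / B → P ∣ A → Comaximal P B → F ≡ fzero [mod P ]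
≡0[mod] {F} {A} {B} {P} den≉0 F≃A/B (k , kP) (comaximal {u₀} {v₀} {e} e≢0 bez) =
  -- `CoprimeP` excludes only nonconstant common divisors, so numerator and denominator may share
  -- the integer `e`.
  constₚ e *ₚ N , constₚ e *ₚ D ,
  (λ z → ≉0-* (constₚ≉0 e≢0) D≉0 (≈ₚ⇒≋ z)) ,
  comaximal⇒coprime (comaximal {u = u} {v} (ℤ-*-≢0 e≢0 c≢0) (begin
    u *ₚ (constₚ e *ₚ N) +ₚ v *ₚ (constₚ e *ₚ D)   ≈⟨ solve 5 (λ u v e N D → u :* (e :* N) :+ v :* (e :* D) := e :* (u :* N :+ v :* D)) ≋-refl u v (constₚ e) N D ⟩
    constₚ e *ₚ (u *ₚ N +ₚ v *ₚ D)                 ≈⟨ *-congˡ (constₚ e) identity ⟩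
    constₚ e *ₚ constₚ c                           ≈⟨ constₚ-homo-* e c ⟨
    constₚ (e ℤ.* c)                               ∎)) ,
  ≋⇒≈ₚ (begin
    constₚ e *ₚ N *ₚ den F′                        ≈⟨ *-assoc (constₚ e) N (den F′) ⟩
    constₚ e *ₚ (N *ₚ den F′)                      ≈⟨ *-congˡ (constₚ e) crossEq ⟩
    constₚ e *ₚ (num F′ *ₚ D)                      ≈⟨ solve 3 (λ e n D → e :* (n :* D) := n :* (e :* D)) ≋-refl (constₚ e) (num F′) D ⟩
    num F′ *ₚ (constₚ e *ₚ D)                      ∎) ,
  ∣⇒∣ₚ (N *ₚ u₀ +ₚ v₀ *ₚ k *ₚ D , (begin
    (N *ₚ u₀ +ₚ v₀ *ₚ k *ₚ D) *ₚ P                 ≈⟨ solve 6 (λ N u v k D P → (N :* u :+ v :* k :* D) :* P := N :* (u :* P) :+ v :* (k :* P :* D)) ≋-refl N u₀ v₀ k D P ⟩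
    N *ₚ (u₀ *ₚ P) +ₚ v₀ *ₚ (k *ₚ P *ₚ D)          ≈⟨ +-cong (≋-refl {N *ₚ (u₀ *ₚ P)}) (*-congˡ v₀ (*-cong kP ≋-refl)) ⟩
    N *ₚ (u₀ *ₚ P) +ₚ v₀ *ₚ (A *ₚ D)               ≈⟨ +-cong (≋-refl {N *ₚ (u₀ *ₚ P)}) (*-congˡ v₀ NB≋AD) ⟨
    N *ₚ (u₀ *ₚ P) +ₚ v₀ *ₚ (N *ₚ B)               ≈⟨ solve 5 (λ N u v P B → N :* (u :* P) :+ v :* (N :* B) := (u :* P :+ v :* B) :* N) ≋-refl N u₀ v₀ P B ⟩
    (u₀ *ₚ P +ₚ v₀ *ₚ B) *ₚ N                      ≈⟨ *-cong bez ≋-refl ⟩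
    constₚ e *ₚ N                                  ∎))
  where
  open ≋R
  F′ = fsub F fzero
  num′≋ : num F′ ≋ num F
  num′≋ = ≋-trans (+-identityʳ (num F *ₚ oneₚ)) (solve 1 (λ n → n :* con 1ℤ := n) ≋-refl (num F))
  den′≋ : den F′ ≋ den F
  den′≋ = ≋-trans (*-comm (den F) oneₚ) (*-identityˡ (den F))
  den′≉0 : ¬ den F′ ≋ []
  den′≉0 z = den≉0 (≋-trans (≋-sym den′≋) z)
  open Reduced (reduceFraction (num F′) (den F′) (bound-length (den F′)) den′≉0)
  open Comaximal coprime
  NB≋AD : (N *ₚ B) ≋ (A *ₚ D)
  NB≋AD = *-cancelˡ (den F′) den′≉0 (begin
    den F′ *ₚ (N *ₚ B)             ≈⟨ solve 3 (λ d N B → d :* (N :* B) := (N :* d) :* B) ≋-refl (den F′) N B ⟩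
    N *ₚ den F′ *ₚ B               ≈⟨ *-cong crossEq ≋-refl ⟩
    num F′ *ₚ D *ₚ B               ≈⟨ *-cong (*-cong num′≋ (≋-refl {D})) (≋-refl {B}) ⟩
    num F *ₚ D *ₚ B                ≈⟨ solve 3 (λ n D B → n :* D :* B := n :* B :* D) ≋-refl (num F) D B ⟩
    num F *ₚ B *ₚ D                ≈⟨ *-cong (crossed F≃A/B) ≋-refl ⟩
    A *ₚ den F *ₚ D                ≈⟨ *-cong (*-congˡ A den′≋) (≋-refl {D}) ⟨
    A *ₚ den F′ *ₚ D               ≈⟨ solve 3 (λ A d D → A :* d :* D := d :* (A :* D)) ≋-refl A (den F′) D ⟩
    den F′ *ₚ (A *ₚ D)             ∎)

-- Powers, geometric sums and the polynomials q^n - 1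

≋-reflexive : ∀ {p r} → p ≡ r → p ≋ r
≋-reflexive refl = ≋-refl

^-cong : ∀ {p r} k → p ≋ r → (p ^ₚ k) ≋ (r ^ₚ k)
^-cong zero    e = ≋-refl
^-cong (suc k) e = *-cong e (^-cong k e)

^-+ : ∀ p a b → (p ^ₚ (a ℕ.+ b)) ≋ (p ^ₚ a *ₚ p ^ₚ b)
^-+ p zero    b = ≋-sym (*-identityˡ (p ^ₚ b))
^-+ p (suc a) b = ≋-trans (*-congˡ p (^-+ p a b)) (≋-sym (*-assoc p (p ^ₚ a) (p ^ₚ b)))

^-* : ∀ p a b → (p ^ₚ (a ℕ.* b)) ≋ ((p ^ₚ b) ^ₚ a)
^-* p zero    b = ≋-refl
^-* p (suc a) b = ≋-trans (^-+ p b (a ℕ.* b)) (*-congˡ (p ^ₚ b) (^-* p a b))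

geometric : Poly → ℕ → Poly
geometric y zero    = []
geometric y (suc k) = oneₚ +ₚ y *ₚ geometric y k

geometric-* : ∀ y k → (geometric y k *ₚ (y -ₚ oneₚ)) ≋ (y ^ₚ k -ₚ oneₚ)
geometric-* y zero    = ≋-sym (+-inverseʳ oneₚ)
geometric-* y (suc k) = begin
  (oneₚ +ₚ y *ₚ g) *ₚ (y -ₚ oneₚ)             ≈⟨ solve 2 (λ y g → (con 1ℤ :+ y :* g) :* (y :- con 1ℤ) := (y :- con 1ℤ) :+ y :* (g :* (y :- con 1ℤ))) ≋-refl y g ⟩
  (y -ₚ oneₚ) +ₚ y *ₚ (g *ₚ (y -ₚ oneₚ))      ≈⟨ +-cong (≋-refl {y -ₚ oneₚ}) (*-congˡ y (geometric-* y k)) ⟩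
  (y -ₚ oneₚ) +ₚ y *ₚ (y ^ₚ k -ₚ oneₚ)        ≈⟨ solve 2 (λ y p → (y :- con 1ℤ) :+ y :* (p :- con 1ℤ) := y :* p :- con 1ℤ) ≋-refl y (y ^ₚ k) ⟩
  y *ₚ y ^ₚ k -ₚ oneₚ                         ∎
  where
  open ≋R
  g = geometric y k

-- Modulo `y - 1` each of the `k` powers of `y` is 1.
geometric-mod : ∀ y k → ∃ λ w → geometric y k ≋ (constₚ (+ k) +ₚ w *ₚ (y -ₚ oneₚ))
geometric-mod y zero    = [] , ≋-sym 0∷[]≋[]
geometric-mod y (suc k) with geometric-mod y k
... | w , e = g +ₚ w , (begin
  oneₚ +ₚ y *ₚ g                                               ≈⟨ solve 2 (λ y g → con 1ℤ :+ y :* g := (con 1ℤ :+ g) :+ g :* (y :- con 1ℤ)) ≋-refl y g ⟩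
  (oneₚ +ₚ g) +ₚ g *ₚ (y -ₚ oneₚ)                              ≈⟨ +-cong (+-cong (≋-refl {oneₚ}) e) ≋-refl ⟩
  (oneₚ +ₚ (constₚ (+ k) +ₚ w *ₚ (y -ₚ oneₚ))) +ₚ g *ₚ (y -ₚ oneₚ)
    ≈⟨ solve 4 (λ y g k w → (con 1ℤ :+ (k :+ w :* (y :- con 1ℤ))) :+ g :* (y :- con 1ℤ) := (con 1ℤ :+ k) :+ (g :+ w) :* (y :- con 1ℤ)) ≋-refl y g (constₚ (+ k)) w ⟩
  constₚ (+ suc k) +ₚ (g +ₚ w) *ₚ (y -ₚ oneₚ)                  ∎)
  where
  open ≋R
  g = geometric y k

comaximal-mod : ∀ {f g c} w → c ≢ 0ℤ → f ≋ (constₚ c +ₚ w *ₚ g) → Comaximal f g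
comaximal-mod {f} {g} {c} w c≢0 e = comaximal {u = oneₚ} { -ₚ w} c≢0 (≋-trans (+-cong (*-congˡ oneₚ e) ≋-refl)
  (solve 3 (λ w g k → con 1ℤ :* (k :+ w :* g) :+ (:- w) :* g := k) ≋-refl w g (constₚ c)))

geometric-comaximal : ∀ y k → Comaximal (geometric y (suc k)) (y -ₚ oneₚ)
geometric-comaximal y k = comaximal-mod (proj₁ m) (λ ()) (proj₂ m)
  where m = geometric-mod y (suc k)

qpow-1 : ℕ → Poly
qpow-1 n = qₚ ^ₚ n -ₚ oneₚ

qpow-1-* : ∀ k d → (geometric (qₚ ^ₚ d) k *ₚ (qpow-1 d)) ≋ (qpow-1 (k ℕ.* d))
qpow-1-* k d = ≋-trans (geometric-* (qₚ ^ₚ d) k) (+-cong (≋-sym (^-* qₚ k d)) ≋-refl)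

qpow-1-∣ : ∀ {d n} → d ℕD.∣ n → (qpow-1 d) ∣ (qpow-1 n)
qpow-1-∣ {d} (ℕD.divides k refl) = geometric (qₚ ^ₚ d) k , qpow-1-* k d

-- If d + y n = x m, then q^d - 1 = (q^(x m) - 1) - q^d (q^(y n) - 1), and the two brackets are
-- multiples of q^m - 1 and q^n - 1.
bézout-qpow-1 : ∀ m n → ∃₂ λ a b → (a *ₚ (qpow-1 m) +ₚ b *ₚ (qpow-1 n)) ≋ (qpow-1 (gcd m n))
bézout-qpow-1 m n = go (Bézout.identity (gcd-GCD m n))
  where
  open ≋R
  d = gcd m n
  split : ∀ m n x y → d ℕ.+ y ℕ.* n ≡ x ℕ.* m →
    (geometric (qₚ ^ₚ m) x *ₚ (qpow-1 m) +ₚ (-ₚ (qₚ ^ₚ d *ₚ geometric (qₚ ^ₚ n) y)) *ₚ (qpow-1 n)) ≋ (qpow-1 d)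
  split m n x y e = begin
    geometric (qₚ ^ₚ m) x *ₚ (qpow-1 m) +ₚ (-ₚ (qₚ ^ₚ d *ₚ geometric (qₚ ^ₚ n) y)) *ₚ (qpow-1 n)
      ≈⟨ +-cong (qpow-1-* x m) (≋-trans (solve 3 (λ a b c → (:- (a :* b)) :* c := :- (a :* (b :* c))) ≋-refl (qₚ ^ₚ d) (geometric (qₚ ^ₚ n) y) (qpow-1 n)) (neg-cong (*-congˡ (qₚ ^ₚ d) (qpow-1-* y n)))) ⟩
    (qpow-1 (x ℕ.* m)) -ₚ qₚ ^ₚ d *ₚ (qpow-1 (y ℕ.* n))
      ≈⟨ +-cong (+-cong (≋-trans (≋-reflexive (≡.cong (qₚ ^ₚ_) (≡.sym e))) (^-+ qₚ d (y ℕ.* n))) (≋-refl { -ₚ oneₚ})) ≋-refl ⟩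
    (qₚ ^ₚ d *ₚ qₚ ^ₚ (y ℕ.* n) -ₚ oneₚ) -ₚ qₚ ^ₚ d *ₚ (qpow-1 (y ℕ.* n))
      ≈⟨ solve 2 (λ a b → (a :* b :- con 1ℤ) :- a :* (b :- con 1ℤ) := a :- con 1ℤ) ≋-refl (qₚ ^ₚ d) (qₚ ^ₚ (y ℕ.* n)) ⟩
    (qpow-1 d) ∎
  split′ : ∀ x y → d ℕ.+ x ℕ.* m ≡ y ℕ.* n →
    (geometric (qₚ ^ₚ n) y *ₚ qpow-1 n +ₚ (-ₚ (qₚ ^ₚ d *ₚ geometric (qₚ ^ₚ m) x)) *ₚ qpow-1 m) ≋ qpow-1 d
  split′ x y e = split n m y x e
  go : Bézout.Identity d m n → ∃₂ λ a b → (a *ₚ (qpow-1 m) +ₚ b *ₚ (qpow-1 n)) ≋ (qpow-1 d)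
  go (Bézout.+- x y e) = geometric (qₚ ^ₚ m) x , -ₚ (qₚ ^ₚ d *ₚ geometric (qₚ ^ₚ n) y) , split m n x y e
  go (Bézout.-+ x y e) = -ₚ (qₚ ^ₚ d *ₚ geometric (qₚ ^ₚ m) x) , geometric (qₚ ^ₚ n) y , ≋-trans (+-comm ((-ₚ (qₚ ^ₚ d *ₚ geometric (qₚ ^ₚ m) x)) *ₚ qpow-1 m) (geometric (qₚ ^ₚ n) y *ₚ (qpow-1 n))) (split′ x y e)

monic-≋ : ∀ {p r L} → p ≋ r → Monic p L → Monic r L
monic-≋ {L = L} e (b , c) = bound-≋ e b , ≡.trans (≡.sym (at e L)) c

monic-q^ : ∀ n → Monic (qₚ ^ₚ n) n
monic-q^ zero    = bound-length oneₚ , refl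
monic-q^ (suc n) = monic-* {qₚ} {qₚ ^ₚ n} {1} (bound-length qₚ , refl) (monic-q^ n)

monic-qpow-1 : ∀ n → Monic (qpow-1 (suc n)) (suc n)
monic-qpow-1 n = bound-- (proj₁ (monic-q^ (suc n))) (bound-mono {oneₚ} (s≤s z≤n) (bound-length oneₚ)) ,
  ≡.trans (coeff-+ (qₚ ^ₚ suc n) (-ₚ oneₚ) (suc n)) (≡.cong (ℤ._+ 0ℤ) (proj₂ (monic-q^ (suc n))))

-- Cyclotomic polynomials

lastOr-∷ʳ : ∀ {A : Set} (d : A) xs x → lastOr d (xs ++ x ∷ []) ≡ x
lastOr-∷ʳ d []           x = refl
lastOr-∷ʳ d (y ∷ [])     x = refl
lastOr-∷ʳ d (y ∷ z ∷ xs) x = lastOr-∷ʳ d (z ∷ xs) x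

length-cycList : ∀ n → length (cycList n) ≡ n
length-cycList zero    = refl
length-cycList (suc n) = ≡.trans (length-++ (cycList n)) (≡.trans (ℕP.+-comm _ 1) (≡.cong suc (length-cycList n)))

-- The conditional factor of `prodDiv`, isolated so that factors at different positions can be
-- interchanged.
times : ∀ {A : Set} → Dec A → Poly → Poly → Poly
times b p = if does b then (p *ₚ_) else id

times-cong : ∀ {A : Set} (b : Dec A) p {r s} → r ≋ s → times b p r ≋ times b p s
times-cong (yes _) p e = *-congˡ p e
times-cong (no _)  p e = e

times-comm : ∀ {A B : Set} (b : Dec A) (c : Dec B) p r s → times b p (times c r s) ≋ times c r (times b p s)
times-comm (yes _) (yes _) p r s = solve 3 (λ p r s → p :* (r :* s) := r :* (p :* s)) ≋-refl p r s
times-comm (yes _) (no _)  p r s = ≋-refl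
times-comm (no _)  _       p r s = ≋-refl

prodDiv-∷ʳ : ∀ m i ps x → prodDiv m i (ps ++ x ∷ []) ≋ times (length ps ℕ.+ i ∣? m) x (prodDiv m i ps)
prodDiv-∷ʳ m i []       x = ≋-refl
prodDiv-∷ʳ m i (p ∷ ps) x = begin
  times (i ∣? m) p (prodDiv m (suc i) (ps ++ x ∷ []))
    ≈⟨ times-cong (i ∣? m) p (prodDiv-∷ʳ m (suc i) ps x) ⟩
  times (i ∣? m) p (times (length ps ℕ.+ suc i ∣? m) x (prodDiv m (suc i) ps))
    ≈⟨ times-comm (i ∣? m) (length ps ℕ.+ suc i ∣? m) p x _ ⟩
  times (length ps ℕ.+ suc i ∣? m) x (prodDiv m i (p ∷ ps))
    ≡⟨ ≡.cong (λ j → times (j ∣? m) x (prodDiv m i (p ∷ ps))) (ℕP.+-suc (length ps) i) ⟩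
  times (suc (length ps ℕ.+ i) ∣? m) x (prodDiv m i (p ∷ ps)) ∎
  where open ≋R

-- The product of `Φ d` over the divisors d ≤ n of `m`. `prodDiv` consumes its list from the front
-- while `cycList` grows at the back; this recursion splits off the last factor.
Ψ : ℕ → ℕ → Poly
Ψ m zero    = oneₚ
Ψ m (suc n) = times (suc n ∣? m) (Φ (suc n)) (Ψ m n)

Φ-suc : ∀ n → Φ (suc n) ≡ divMonic (qpow-1 (suc n)) (prodDiv (suc n) 1 (cycList n))
Φ-suc n = lastOr-∷ʳ oneₚ (cycList n) _

prodDiv≋Ψ : ∀ m n → prodDiv m 1 (cycList n) ≋ Ψ m n
prodDiv≋Ψ m zero    = ≋-refl
prodDiv≋Ψ m (suc n) = begin
  prodDiv m 1 (cycList n ++ x ∷ [])                              ≈⟨ prodDiv-∷ʳ m 1 (cycList n) x ⟩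
  times (length (cycList n) ℕ.+ 1 ∣? m) x (prodDiv m 1 (cycList n))
    ≡⟨ ≡.cong₂ (λ j x → times (j ∣? m) x (prodDiv m 1 (cycList n))) (≡.trans (ℕP.+-comm _ 1) (≡.cong suc (length-cycList n))) (≡.sym (Φ-suc n)) ⟩
  times (suc n ∣? m) (Φ (suc n)) (prodDiv m 1 (cycList n))       ≈⟨ times-cong (suc n ∣? m) (Φ (suc n)) (prodDiv≋Ψ m n) ⟩
  times (suc n ∣? m) (Φ (suc n)) (Ψ m n)                         ∎
  where
  open ≋R
  x = divMonic (qpow-1 (suc n)) (prodDiv (suc n) 1 (cycList n))

times-yes : ∀ {A : Set} (b : Dec A) p r → A → times b p r ≋ (p *ₚ r)
times-yes (yes _) p r a = ≋-refl
times-yes (no ¬a) p r a = contradiction a ¬a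

times-no : ∀ {A : Set} (b : Dec A) p r → ¬ A → times b p r ≋ r
times-no (yes a) p r ¬a = contradiction a ¬a
times-no (no _)  p r ¬a = ≋-refl

Ψ-suc-∣ : ∀ {m n} → suc n ℕD.∣ m → Ψ m (suc n) ≋ (Φ (suc n) *ₚ Ψ m n)
Ψ-suc-∣ {m} {n} = times-yes (suc n ∣? m) (Φ (suc n)) (Ψ m n)

Ψ-suc-∤ : ∀ {m n} → ¬ suc n ℕD.∣ m → Ψ m (suc n) ≋ Ψ m n
Ψ-suc-∤ {m} {n} = times-no (suc n ∣? m) (Φ (suc n)) (Ψ m n)

Ψ-suc-self : ∀ n → Ψ (suc n) (suc n) ≋ (Φ (suc n) *ₚ Ψ (suc n) n)
Ψ-suc-self n = Ψ-suc-∣ {suc n} {n} ℕD.∣-refl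

-- A divisor of `g` also divides `m`, so no factor on the left is missing on the right.
Ψ-monotone : ∀ {g m} n → g ℕD.∣ m → Ψ g n ∣ Ψ m n
Ψ-monotone zero    _ = ∣-refl
Ψ-monotone {g} {m} (suc n) g∣m = go (suc n ∣? g) (suc n ∣? m)
  where
  ih = Ψ-monotone n g∣m
  go : Dec (suc n ℕD.∣ g) → Dec (suc n ℕD.∣ m) → Ψ g (suc n) ∣ Ψ m (suc n)
  go (yes d) (yes e) = ≋-∣ (≋-sym (Ψ-suc-∣ {g} d)) (∣-≋ (≋-sym (Ψ-suc-∣ {m} e)) (∣-* (∣-refl {Φ (suc n)}) ih))
  go (yes d) (no ∤)  = contradiction (ℕD.∣-trans d g∣m) ∤
  go (no ∤)  (yes e) = ≋-∣ (≋-sym (Ψ-suc-∤ {g} ∤)) (∣-≋ (≋-sym (Ψ-suc-∣ {m} e)) (∣-*ˡ (Φ (suc n)) ih))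
  go (no ∤)  (no ∤′) = ≋-∣ (≋-sym (Ψ-suc-∤ {g} ∤)) (∣-≋ (≋-sym (Ψ-suc-∤ {m} ∤′)) ih)

Ψ-stable : ∀ m k → Ψ (suc m) (k ℕ.+ suc m) ≋ Ψ (suc m) (suc m)
Ψ-stable m zero    = ≋-refl
Ψ-stable m (suc k) = ≋-trans (Ψ-suc-∤ {suc m} {k ℕ.+ suc m} λ d → contradiction (ℕD.∣⇒≤ d) (ℕP.<⇒≱ (s≤s (ℕP.m≤n+m (suc m) k))))
  (Ψ-stable m k)

-- What the induction carries: the product formula gives comaximality, and monicity permits the next
-- division over ℤ.
record Cyclotomic (i : ℕ) : Set where
  field
    product  : Ψ i i ≋ (qpow-1 i)
    {degree} : ℕ
    monic    : Monic (Φ i) degree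
open Cyclotomic

CyclotomicUpTo : ℕ → Set
CyclotomicUpTo n = ∀ i → suc i ℕ.≤ n → Cyclotomic (suc i)

Φ∣qpow-1 : ∀ {i} → Cyclotomic (suc i) → Φ (suc i) ∣ (qpow-1 (suc i))
Φ∣qpow-1 {i} c = Ψ (suc i) i , ≋-trans (*-comm (Ψ (suc i) i) (Φ (suc i))) (≋-trans (≋-sym (Ψ-suc-self i)) (product c))

-- In the product formula for `suc i`, the factors other than `Φ (suc i)` include every `Φ d` with d
-- dividing `suc g`, and these multiply to `qpow-1 (suc g)`.
Φ*qpow-1∣qpow-1 : ∀ {i g} → Cyclotomic (suc i) → Cyclotomic (suc g) → suc g ℕD.∣ suc i → suc g ℕ.≤ i →
  (Φ (suc i) *ₚ (qpow-1 (suc g))) ∣ (qpow-1 (suc i))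
Φ*qpow-1∣qpow-1 {i} {g} ci cg g∣i g<i = ∣-≋ (≋-trans (≋-sym (Ψ-suc-self i)) (product ci))
  (∣-* (∣-refl {Φ (suc i)}) (proj₁ d , ≋-trans (*-congˡ (proj₁ d) (≋-trans (≋-sym (product cg)) (≋-sym stable))) (proj₂ d)))
  where
  d = Ψ-monotone i g∣i
  stable : Ψ (suc g) i ≋ Ψ (suc g) (suc g)
  stable = ≋-trans (≋-reflexive (≡.cong (Ψ (suc g)) (≡.sym (ℕP.m∸n+n≡m g<i)))) (Ψ-stable g (i ∸ suc g))

qpow-1≉0 : ∀ g → ¬ (qpow-1 (suc g)) ≋ []
qpow-1≉0 g = degree⇒≉0 (monic⇒degree (monic-qpow-1 g))

∣-cancelʳ : ∀ {f g h} → ¬ h ≋ [] → (f *ₚ h) ∣ (g *ₚ h) → f ∣ g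
∣-cancelʳ {f} {g} {h} h≉0 (M , e) = M , *-cancelˡ h h≉0 (begin
  h *ₚ (M *ₚ f)     ≈⟨ solve 3 (λ h M f → h :* (M :* f) := M :* (f :* h)) ≋-refl h M f ⟩
  M *ₚ (f *ₚ h)     ≈⟨ e ⟩
  g *ₚ h            ≈⟨ *-comm g h ⟩
  h *ₚ g            ∎)
  where open ≋R

-- `Φ (suc i)` divides the quotient of `qpow-1 (suc i)` by `qpow-1 (suc g)`. That quotient is a
-- geometric sum in q^(g+1), congruent modulo q^(g+1) - 1 to its number of terms, a nonzero integer.
Φ-comaximal-divisor : ∀ {i g} → Cyclotomic (suc i) → Cyclotomic (suc g) → suc g ℕD.∣ suc i → suc g ℕ.≤ i →
  Comaximal (Φ (suc i)) (qpow-1 (suc g))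
Φ-comaximal-divisor {i} {g} ci cg g∣i@(ℕD.divides (suc k) e) g<i =
  comaximal-∣ˡ (∣-cancelʳ (qpow-1≉0 g) (∣-≋ (≋-sym (≋-trans (qpow-1-* (suc k) (suc g)) (≋-reflexive (≡.cong qpow-1 (≡.sym e)))))
    (Φ*qpow-1∣qpow-1 ci cg g∣i g<i))) (geometric-comaximal (qₚ ^ₚ suc g) k)

-- The Bézout identity replaces the exponent by its gcd with `suc i`, which is a proper divisor of
-- `suc i`.
Φ-comaximal-qpow-1 : ∀ {i d} → CyclotomicUpTo (suc i) → suc d ℕ.≤ i → Comaximal (Φ (suc i)) (qpow-1 (suc d))
Φ-comaximal-qpow-1 {i} {d} H d<i with gcd (suc i) (suc d) in eq | bézout-qpow-1 (suc i) (suc d)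
... | zero  | _ = contradiction (ℕD.0∣⇒≡0 (≡.subst (ℕD._∣ suc d) eq (gcd[m,n]∣n (suc i) (suc d)))) λ ()
... | suc g | a , b , e = comaximal-combine {a = a *ₚ M} {b}
    (≋-trans (+-cong (≋-trans (*-assoc a M (Φ (suc i))) (*-congˡ a (proj₂ Φ∣))) (≋-refl {b *ₚ qpow-1 (suc d)})) e)
    (Φ-comaximal-divisor (H i ℕP.≤-refl) (H g (ℕP.≤-trans g≤d (ℕP.≤-trans d<i (ℕP.n≤1+n i)))) g∣i (ℕP.≤-trans g≤d d<i))
  where
  g∣i : suc g ℕD.∣ suc i
  g∣i = ≡.subst (ℕD._∣ suc i) eq (gcd[m,n]∣m (suc i) (suc d))
  g≤d : suc g ℕ.≤ suc d
  g≤d = ℕD.∣⇒≤ (≡.subst (ℕD._∣ suc d) eq (gcd[m,n]∣n (suc i) (suc d)))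
  Φ∣ : Φ (suc i) ∣ qpow-1 (suc i)
  Φ∣ = Φ∣qpow-1 (H i ℕP.≤-refl)
  M = proj₁ Φ∣

Φ-comaximal-Ψ : ∀ {i} m j → CyclotomicUpTo (suc i) → j ℕ.≤ i → Comaximal (Φ (suc i)) (Ψ m j)
Φ-comaximal-Ψ m zero    H j≤i = comaximal-1ʳ
Φ-comaximal-Ψ {i} m (suc j) H j<i = go (suc j ∣? m)
  where
  ih = Φ-comaximal-Ψ m j H (ℕP.<⇒≤ j<i)
  go : Dec (suc j ℕD.∣ m) → Comaximal (Φ (suc i)) (Ψ m (suc j))
  go (no ∤)  = comaximal-∣ʳ (≋-∣ (≋-sym (Ψ-suc-∤ {m} ∤)) ∣-refl) ih
  go (yes d) = comaximal-∣ʳ (≋-∣ (≋-sym (Ψ-suc-∣ {m} d)) ∣-refl)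
    (comaximal-*ʳ (comaximal-∣ʳ (Φ∣qpow-1 (H j (ℕP.≤-trans j<i (ℕP.n≤1+n i)))) (Φ-comaximal-qpow-1 H j<i)) ih)

-- Each factor divides `qpow-1 m` separately; comaximality with the factors before it makes the
-- whole product divide.
Ψ-monic-∣ : ∀ m j → CyclotomicUpTo j → ∃ (Monic (Ψ m j)) × Ψ m j ∣ (qpow-1 m)
Ψ-monic-∣ m zero    H = (0 , bound-length oneₚ , refl) , ((qpow-1 m) , solve 1 (λ x → x :* con 1ℤ := x) ≋-refl (qpow-1 m))
Ψ-monic-∣ m (suc j) H = go (suc j ∣? m)
  where
  ih = Ψ-monic-∣ m j (λ i le → H i (ℕP.≤-trans le (ℕP.n≤1+n j)))
  monicΨ = proj₂ (proj₁ ih)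
  monicΦ = monic (H j ℕP.≤-refl)
  go : Dec (suc j ℕD.∣ m) → ∃ (Monic (Ψ m (suc j))) × Ψ m (suc j) ∣ qpow-1 m
  go (no ∤)  = (_ , monic-≋ (≋-sym (Ψ-suc-∤ {m} ∤)) monicΨ) , ≋-∣ (≋-sym (Ψ-suc-∤ {m} ∤)) (proj₂ ih)
  go (yes d) = (_ , monic-≋ (≋-sym (Ψ-suc-∣ {m} d)) (monic-* monicΦ monicΨ)) , ≋-∣ (≋-sym (Ψ-suc-∣ {m} d))
    (comaximal-*-∣ monicΦ monicΨ (Φ-comaximal-Ψ m j H ℕP.≤-refl)
      (∣-trans (Φ∣qpow-1 (H j ℕP.≤-refl)) (qpow-1-∣ d)) (proj₂ ih))

monic-quotient : ∀ {M b h B H} → Monic b B → Monic h H → (M *ₚ b) ≋ h → ∃ (Monic M)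
monic-quotient {M} {b} {h} {B} {H} mb mh e with leading M
... | inj₁ z       = contradiction (≋-trans (≋-sym e) (*-cong z (≋-refl {b}))) (degree⇒≉0 (monic⇒degree mh))
... | inj₂ (m , d) = m , proj₁ d , (begin
  coeff M m                    ≡⟨ ℤP.*-identityʳ (coeff M m) ⟨
  coeff M m ℤ.* 1ℤ             ≡⟨ ≡.cong (coeff M m ℤ.*_) (proj₂ mb) ⟨
  coeff M m ℤ.* coeff b B      ≡⟨ proj₂ (coeff-* m B (proj₁ d) (proj₁ mb)) ⟨
  coeff (M *ₚ b) (m ℕ.+ B)     ≡⟨ at e (m ℕ.+ B) ⟩
  coeff h (m ℕ.+ B)            ≡⟨ ≡.cong (coeff h) (degree-unique (degree-≋ e (degree-* d (monic⇒degree mb))) (monic⇒degree mh)) ⟩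
  coeff h H                    ≡⟨ proj₂ mh ⟩
  1ℤ                           ∎)
  where open ≡.≡-Reasoning

-- By `Ψ-monic-∣` the division that defines `Φ (suc n)` is exact, and its result is the cofactor
-- `M`.
cyclotomic-suc : ∀ n → CyclotomicUpTo n → Cyclotomic (suc n)
cyclotomic-suc n H with Ψ-monic-∣ (suc n) n H
... | (_ , monicΨ) , M , e = record
  { product = ≋-trans (Ψ-suc-self n) (≋-trans (*-cong Φ≋M (≋-refl {Ψ (suc n) n})) e)
  ; monic   = monic-≋ (≋-sym Φ≋M) (proj₂ (monic-quotient monicΨ (monic-qpow-1 n) e)) }
  where
  prodDiv≋ : prodDiv (suc n) 1 (cycList n) ≋ Ψ (suc n) n
  prodDiv≋ = prodDiv≋Ψ (suc n) n
  Φ≋M : Φ (suc n) ≋ M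
  Φ≋M = ≋-trans (≋-reflexive (Φ-suc n))
    (divMonic-exact (monic-≋ (≋-sym prodDiv≋) monicΨ) (qpow-1 (suc n)) M (≋-trans (*-congˡ M prodDiv≋) e))

cyclotomicUpTo : ∀ n → CyclotomicUpTo n
cyclotomicUpTo (suc n) i (s≤s i≤n) with ℕP.m≤n⇒m<n∨m≡n i≤n
... | inj₁ i<n  = cyclotomicUpTo n i i<n
... | inj₂ refl = cyclotomic-suc n (cyclotomicUpTo n)

-- q-integers modulo q^d - 1

qint≋geometric : ∀ n → qint n ≋ geometric qₚ n
qint≋geometric zero    = ≋-refl
qint≋geometric (suc n) = ≋-trans (∷≋ 1ℤ (qint n)) (+-cong (≋-refl {oneₚ}) (*-congˡ qₚ (qint≋geometric n)))

qint-* : ∀ n → (qint n *ₚ (qpow-1 1)) ≋ (qpow-1 n)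
qint-* n = ≋-trans (*-cong (qint≋geometric n) (+-cong (solve 1 (λ q → q :* con 1ℤ := q) ≋-refl qₚ) (≋-refl { -ₚ oneₚ}))) (geometric-* qₚ n)

qint∣qpow-1 : ∀ n → qint n ∣ (qpow-1 n)
qint∣qpow-1 n = (qpow-1 1) , ≋-trans (*-comm (qpow-1 1) (qint n)) (qint-* n)

qint-comaximal-q-1 : ∀ n → Comaximal (qint (suc n)) (qpow-1 1)
qint-comaximal-q-1 n = comaximal-∣ʳ (oneₚ , solve 1 (λ q → con 1ℤ :* (q :* con 1ℤ :- con 1ℤ) := q :- con 1ℤ) ≋-refl qₚ)
  (comaximal-∣ˡ (oneₚ , ≋-trans (*-identityˡ (qint (suc n))) (qint≋geometric (suc n))) (geometric-comaximal qₚ n))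

-- The divisor 1 in `Φ*qpow-1∣qpow-1`, with `q - 1` cancelled; it is a proper divisor because the
-- index is at least 2.
Φ∣qint : ∀ n → Φ (suc (suc n)) ∣ qint (suc (suc n))
Φ∣qint n = ∣-cancelʳ (qpow-1≉0 0) (∣-≋ (≋-sym (qint-* (suc (suc n))))
  (Φ*qpow-1∣qpow-1 {suc n} {0} (H (suc n) ℕP.≤-refl) (H 0 (s≤s z≤n)) (ℕD.1∣ suc (suc n)) (s≤s z≤n)))
  where H = cyclotomicUpTo (suc (suc n))

-- For coprime exponents Bézout puts `q - 1` into the ideal, and the value of the q-integer at q = 1
-- is a positive integer.
qint-comaximal-qpow-1 : ∀ n d → gcd (suc n) d ≡ 1 → Comaximal (qint (suc n)) (qpow-1 d)
qint-comaximal-qpow-1 n d e with bézout-qpow-1 (suc n) d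
... | a , b , i = comaximal-combine {a = a *ₚ (qpow-1 1)} {b}
  (≋-trans (+-cong (≋-trans (*-assoc a (qpow-1 1) (qint (suc n))) (*-congˡ a (proj₂ (qint∣qpow-1 (suc n))))) ≋-refl)
    (≋-trans i (≋-reflexive (≡.cong qpow-1 e))))
  (qint-comaximal-q-1 n)

-- Values of fractions

≃-resp : ∀ {F a a′ b b′} → a ≋ a′ → b ≋ b′ → F ≃ a / b → F ≃ a′ / b′
≃-resp {F} e f (cross v) = cross (≋-trans (*-congˡ (num F) (≋-sym f)) (≋-trans v (*-cong e ≋-refl)))

≃-scale : ∀ {F a b} c → F ≃ a / b → F ≃ c *ₚ a / c *ₚ b
≃-scale {F} {a} {b} c (cross v) = cross (begin
  num F *ₚ (c *ₚ b)   ≈⟨ solve 3 (λ n c b → n :* (c :* b) := c :* (n :* b)) ≋-refl (num F) c b ⟩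
  c *ₚ (num F *ₚ b)   ≈⟨ *-congˡ c v ⟩
  c *ₚ (a *ₚ den F)   ≈⟨ *-assoc c a (den F) ⟨
  c *ₚ a *ₚ den F     ∎)
  where open ≋R

≃-cancel : ∀ {F a b} c → ¬ c ≋ [] → F ≃ c *ₚ a / c *ₚ b → F ≃ a / b
≃-cancel {F} {a} {b} c c≉0 (cross v) = cross (*-cancelˡ c c≉0 (begin
  c *ₚ (num F *ₚ b)   ≈⟨ solve 3 (λ n c b → c :* (n :* b) := n :* (c :* b)) ≋-refl (num F) c b ⟩
  num F *ₚ (c *ₚ b)   ≈⟨ v ⟩
  c *ₚ a *ₚ den F     ≈⟨ *-assoc c a (den F) ⟩
  c *ₚ (a *ₚ den F)   ∎))
  where open ≋R

≃-fpoly : ∀ p → fpoly p ≃ p / oneₚ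
≃-fpoly p = cross ≋-refl

≃-fmul : ∀ {F G a b c d} → F ≃ a / b → G ≃ c / d → fmul F G ≃ a *ₚ c / b *ₚ d
≃-fmul {F} {G} {a} {b} {c} {d} (cross v) (cross w) = cross (begin
  num F *ₚ num G *ₚ (b *ₚ d)       ≈⟨ solve 4 (λ f g b d → f :* g :* (b :* d) := (f :* b) :* (g :* d)) ≋-refl (num F) (num G) b d ⟩
  (num F *ₚ b) *ₚ (num G *ₚ d)     ≈⟨ *-cong v w ⟩
  (a *ₚ den F) *ₚ (c *ₚ den G)     ≈⟨ solve 4 (λ f g a c → (a :* f) :* (c :* g) := a :* c :* (f :* g)) ≋-refl (den F) (den G) a c ⟩
  a *ₚ c *ₚ (den F *ₚ den G)       ∎)
  where open ≋R

≃-fdiv : ∀ {F G a b c d} → F ≃ a / b → G ≃ c / d → fdiv F G ≃ a *ₚ d / b *ₚ c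
≃-fdiv {F} {G} {a} {b} {c} {d} (cross v) (cross w) = cross (begin
  num F *ₚ den G *ₚ (b *ₚ c)       ≈⟨ solve 4 (λ f g b c → f :* g :* (b :* c) := (f :* b) :* (c :* g)) ≋-refl (num F) (den G) b c ⟩
  (num F *ₚ b) *ₚ (c *ₚ den G)     ≈⟨ *-cong v (≋-sym w) ⟩
  (a *ₚ den F) *ₚ (num G *ₚ d)     ≈⟨ solve 4 (λ f g a d → (a :* f) :* (g :* d) := a :* d :* (f :* g)) ≋-refl (den F) (num G) a d ⟩
  a *ₚ d *ₚ (den F *ₚ num G)       ∎)
  where open ≋R

≃-fadd : ∀ {F G a b c d} → F ≃ a / b → G ≃ c / d → fadd F G ≃ a *ₚ d +ₚ c *ₚ b / b *ₚ d
≃-fadd {F} {G} {a} {b} {c} {d} (cross v) (cross w) = cross (begin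
  (num F *ₚ den G +ₚ num G *ₚ den F) *ₚ (b *ₚ d)
    ≈⟨ solve 6 (λ f f′ g g′ b d → (f :* g′ :+ g :* f′) :* (b :* d) := (f :* b) :* (g′ :* d) :+ (g :* d) :* (f′ :* b)) ≋-refl (num F) (den F) (num G) (den G) b d ⟩
  (num F *ₚ b) *ₚ (den G *ₚ d) +ₚ (num G *ₚ d) *ₚ (den F *ₚ b)
    ≈⟨ +-cong (*-cong v (≋-refl {den G *ₚ d})) (*-cong w (≋-refl {den F *ₚ b})) ⟩
  (a *ₚ den F) *ₚ (den G *ₚ d) +ₚ (c *ₚ den G) *ₚ (den F *ₚ b)
    ≈⟨ solve 6 (λ f g a b c d → (a :* f) :* (g :* d) :+ (c :* g) :* (f :* b) := (a :* d :+ c :* b) :* (f :* g)) ≋-refl (den F) (den G) a b c d ⟩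
  (a *ₚ d +ₚ c *ₚ b) *ₚ (den F *ₚ den G) ∎)
  where open ≋R

1^k≋1 : ∀ k → (oneₚ ^ₚ k) ≋ oneₚ
1^k≋1 zero    = ≋-refl
1^k≋1 (suc k) = ≋-trans (*-identityˡ (oneₚ ^ₚ k)) (1^k≋1 k)

≃-fpow : ∀ p k → fpow (fpoly p) k ≃ p ^ₚ k / oneₚ
≃-fpow p zero    = cross ≋-refl
≃-fpow p (suc k) = ≃-resp ≋-refl (*-identityˡ oneₚ)
  (≃-fmul (≃-fpoly p) (≃-fpow p k))

-- pochₚ a b p k is b^k (a/b; p)_k.
pochₚ : Poly → Poly → Poly → ℕ → Poly
pochₚ a b p zero    = oneₚ
pochₚ a b p (suc k) = pochₚ a b p k *ₚ (b -ₚ a *ₚ p ^ₚ k)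

≃-poch : ∀ {x a b} p k → x ≃ a / b → poch x (fpoly p) k ≃ pochₚ a b p k / b ^ₚ k
≃-poch p zero    v = cross ≋-refl
≃-poch {x} {a} {b} p (suc k) v = ≃-resp ≋-refl (*-comm (b ^ₚ k) b)
  (≃-fmul (≃-poch p k v) factor)
  where
  y = fmul x (fpow (fpoly p) k)
  w : y ≃ a *ₚ p ^ₚ k / b
  w = ≃-resp ≋-refl (solve 1 (λ b → b :* con 1ℤ := b) ≋-refl b) (≃-fmul v (≃-fpow p k))
  open ≋R
  factor : fsub fone y ≃ b -ₚ a *ₚ p ^ₚ k / b
  factor = cross (begin
    (oneₚ *ₚ den y -ₚ num y *ₚ oneₚ) *ₚ b          ≈⟨ solve 3 (λ d n b → (con 1ℤ :* d :- n :* con 1ℤ) :* b := b :* d :- n :* b) ≋-refl (den y) (num y) b ⟩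
    b *ₚ den y -ₚ num y *ₚ b                       ≈⟨ +-cong (≋-refl {b *ₚ den y}) (neg-cong (crossed w)) ⟩
    b *ₚ den y -ₚ a *ₚ p ^ₚ k *ₚ den y             ≈⟨ solve 3 (λ b d c → b :* d :- c :* d := (b :- c) :* (con 1ℤ :* d)) ≋-refl b (den y) (a *ₚ p ^ₚ k) ⟩
    (b -ₚ a *ₚ p ^ₚ k) *ₚ (oneₚ *ₚ den y)          ∎)

≃-poch₁ : ∀ a p k → poch (fpoly a) (fpoly p) k ≃ pochₚ a oneₚ p k / oneₚ
≃-poch₁ a p k = ≃-resp ≋-refl (1^k≋1 k) (≃-poch p k (≃-fpoly a))

1≉0 : ¬ oneₚ ≋ []
1≉0 = constₚ≉0 1≢0

q≉0 : ¬ qₚ ≋ []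
q≉0 e = 1≢0 (at e 1)

^≉0 : ∀ {p} k → ¬ p ≋ [] → ¬ (p ^ₚ k) ≋ []
^≉0 zero    _   = 1≉0
^≉0 (suc k) p≉0 = ≉0-* p≉0 (^≉0 k p≉0)

den-fpow≉0 : ∀ p k → ¬ den (fpow (fpoly p) k) ≋ []
den-fpow≉0 p zero    = 1≉0
den-fpow≉0 p (suc k) = ≉0-* 1≉0 (den-fpow≉0 p k)

den-poch≉0 : ∀ {x} p k → ¬ den x ≋ [] → ¬ den (poch x (fpoly p) k) ≋ []
den-poch≉0 p zero    _   = 1≉0
den-poch≉0 p (suc k) x≉0 = ≉0-* (den-poch≉0 p k x≉0) (≉0-* 1≉0 (≉0-* x≉0 (den-fpow≉0 p k)))

≃≉0 : ∀ {F a b} → ¬ a ≋ [] → ¬ den F ≋ [] → F ≃ a / b → ¬ num F ≋ []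
≃≉0 {F} {a} {b} a≉0 d≉0 v z = ≉0-* a≉0 d≉0 (≋-trans (≋-sym (crossed v)) (*-cong z (≋-refl {b})))

one-q*≉0 : ∀ p → ¬ (oneₚ -ₚ qₚ *ₚ p) ≋ []
one-q*≉0 p e = 1≢0 (≡.trans (≡.sym c) (at e 0))
  where
  c : coeff (oneₚ -ₚ qₚ *ₚ p) 0 ≡ 1ℤ
  c = at (+-cong (≋-refl {oneₚ}) (neg-cong (≋-trans (0∷-* oneₚ p) (≋-refl {0ℤ ∷ oneₚ *ₚ p})))) 0

-- Every factor is 1 minus a multiple of `q` and so has constant coefficient 1.
pochₚ-q*≉0 : ∀ a p k → ¬ pochₚ (qₚ *ₚ a) oneₚ p k ≋ []
pochₚ-q*≉0 a p zero    = 1≉0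
pochₚ-q*≉0 a p (suc k) = ≉0-* (pochₚ-q*≉0 a p k) λ e → one-q*≉0 (a *ₚ p ^ₚ k)
  (≋-trans (+-cong (≋-refl {oneₚ}) (neg-cong (≋-sym (*-assoc qₚ a (p ^ₚ k))))) e)

-- The summand in factored form

q² : Poly
q² = qₚ ^ₚ 2

-- In q-notation: q^k (q^-1;q²)_k, (q;q²)_k, (q²;q²)_k and (q⁴;q²)_k.
A O E₂ E₄ : ℕ → Poly
A  = pochₚ oneₚ qₚ q²
O  = pochₚ qₚ oneₚ q²
E₂ = pochₚ q² oneₚ q²
E₄ = pochₚ (qₚ ^ₚ 4) oneₚ q²

E₂≉0 : ∀ k → ¬ E₂ k ≋ []
E₂≉0 = pochₚ-q*≉0 (qₚ ^ₚ 1) q²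

E₄≉0 : ∀ k → ¬ E₄ k ≋ []
E₄≉0 = pochₚ-q*≉0 (qₚ ^ₚ 3) q²

termNum termDen : ℕ → Poly
termNum k = qint (4 ℕ.* k ℕ.+ 1) *ₚ (A k ^ₚ 3 *ₚ O k *ₚ qₚ ^ₚ (6 ℕ.* k))
termDen k = (qₚ ^ₚ k) ^ₚ 3 *ₚ (E₄ k ^ₚ 3 *ₚ E₂ k)

≃-cube : ∀ {F a b} → F ≃ a / b → cube F ≃ a *ₚ (a *ₚ a) / b *ₚ (b *ₚ b)
≃-cube {F} v = ≃-fmul v (≃-fmul v v)

module _ (k : ℕ) where
  private
    PA = poch qinv (fpoly q²) k
    PO = poch qF (fpoly q²) k
    P₄ = poch (fpoly (qₚ ^ₚ 4)) (fpoly q²) k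
    P₂ = poch (fpoly q²) (fpoly q²) k
    y = qₚ ^ₚ k
    numerator denominator : Frac
    numerator = fmul (cube PA) PO
    denominator = fmul (cube P₄) P₂

    ≃-A : PA ≃ A k / y
    ≃-A = ≃-poch q² k (cross ≋-refl)

    ≃-numerator : numerator ≃ A k *ₚ (A k *ₚ A k) *ₚ O k / y *ₚ (y *ₚ y) *ₚ oneₚ
    ≃-numerator = ≃-fmul (≃-cube ≃-A) (≃-poch₁ qₚ q² k)

    ≃-denominator : denominator ≃ E₄ k *ₚ (E₄ k *ₚ E₄ k) *ₚ E₂ k / oneₚ *ₚ (oneₚ *ₚ oneₚ) *ₚ oneₚ
    ≃-denominator = ≃-fmul (≃-cube (≃-poch₁ (qₚ ^ₚ 4) q² k)) (≃-poch₁ q² q² k)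

  ≃-term : term k ≃ termNum k / termDen k
  ≃-term = ≃-resp
    (solve 4 (λ i a o x → i :* (a :* (a :* a) :* o :* (con 1ℤ :* (con 1ℤ :* con 1ℤ) :* con 1ℤ) :* x) := i :* (a :^ 3 :* o :* x)) ≋-refl (qint (4 ℕ.* k ℕ.+ 1)) (A k) (O k) (qₚ ^ₚ (6 ℕ.* k)))
    (solve 3 (λ y e f → con 1ℤ :* (y :* (y :* y) :* con 1ℤ :* (e :* (e :* e) :* f) :* con 1ℤ) := y :^ 3 :* (e :^ 3 :* f)) ≋-refl y (E₄ k) (E₂ k))
    (≃-fmul (≃-fpoly (qint (4 ℕ.* k ℕ.+ 1)))
      (≃-fmul (≃-fdiv ≃-numerator ≃-denominator) (≃-fpoly (qₚ ^ₚ (6 ℕ.* k)))))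

  den-term≉0 : ¬ den (term k) ≋ []
  den-term≉0 = ≉0-* 1≉0 (≉0-* (≉0-* den-numerator num-denominator) 1≉0)
    where
    den-PA = den-poch≉0 {qinv} q² k q≉0
    den-P₄ = den-poch≉0 {fpoly (qₚ ^ₚ 4)} q² k 1≉0
    den-P₂ = den-poch≉0 {fpoly q²} q² k 1≉0
    den-numerator : ¬ den numerator ≋ []
    den-numerator = ≉0-* (≉0-* den-PA (≉0-* den-PA den-PA)) (den-poch≉0 {qF} q² k 1≉0)
    -- `fdiv` moves the numerator of its divisor into the denominator.
    num-denominator : ¬ num denominator ≋ []
    num-denominator = ≃≉0 {denominator} (≉0-* (≉0-* (E₄≉0 k) (≉0-* (E₄≉0 k) (E₄≉0 k))) (E₂≉0 k))
      (≉0-* (≉0-* den-P₄ (≉0-* den-P₄ den-P₄)) den-P₂) ≃-denominator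

den-sumTerms≉0 : ∀ K → ¬ den (sumTerms K) ≋ []
den-sumTerms≉0 zero    = den-term≉0 0
den-sumTerms≉0 (suc K) = ≉0-* (den-sumTerms≉0 K) (den-term≉0 (suc K))

-- Gosper summation

-- If x = q^(2k) and t is the k-th term without its factor [4k+1], then x^-3 h(x) (1 - x) (1 - q^2 x)^3 t
-- is an antidifference of the terms, up to a constant; h was found by undetermined coefficients.
h : Poly → Poly → Poly
h q x = q *ₚ q *ₚ s *ₚ s *ₚ r
   +ₚ x *ₚ (-ₚ (q *ₚ u) +ₚ x *ₚ (constₚ (+ 3) +ₚ q *ₚ (constₚ (+ 3) +ₚ q *ₚ (constₚ (+ 13) +ₚ q *ₚ (constₚ (+ 10) +ₚ q *ₚ (constₚ (+ 13) +ₚ q *ₚ (constₚ (+ 3) +ₚ q *ₚ constₚ (+ 3))))))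
   +ₚ x *ₚ (-ₚ u +ₚ x *ₚ (s *ₚ s *ₚ r))))
  where
  s r u : Poly
  s = oneₚ +ₚ q
  r = oneₚ +ₚ q *ₚ q
  u = s *ₚ r *ₚ (constₚ (+ 3) +ₚ q *ₚ (constₚ (+ 2) +ₚ q *ₚ constₚ (+ 3)))

:h : ∀ {n} → Polynomial n → Polynomial n → Polynomial n
:h q x = q :* q :* s :* s :* r
   :+ x :* (:- (q :* u) :+ x :* (con (+ 3) :+ q :* (con (+ 3) :+ q :* (con (+ 13) :+ q :* (con (+ 10) :+ q :* (con (+ 13) :+ q :* (con (+ 3) :+ q :* con (+ 3))))))
   :+ x :* (:- u :+ x :* (s :* s :* r))))
  where
  s = con (+ 1) :+ q
  r = con (+ 1) :+ q :* q
  u = s :* r :* (con (+ 3) :+ q :* (con (+ 2) :+ q :* con (+ 3)))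

-- Independent of `x`, hence a constant of the summation. Its factor q³ - 1, like 1 - q^(n+3), is
-- what n > 3 and gcd(n,3) = 1 guard against.
κ : Poly → Poly
κ q = q ^ₚ 2 *ₚ (oneₚ -ₚ q) ^ₚ 4 *ₚ (q ^ₚ 3 -ₚ oneₚ) ^ₚ 3

-- The telescoping relation with denominators cleared: the ratio of consecutive `t` turns the
-- shifted antidifference into the left side, and 1 - q x² is (1 - q)[4k+1].
gosper : ∀ q x → (h q (q ^ₚ 2 *ₚ x) *ₚ (oneₚ -ₚ q *ₚ x) *ₚ (q -ₚ x) ^ₚ 3)
  ≋ (q ^ₚ 3 *ₚ h q x *ₚ (oneₚ -ₚ x) *ₚ (oneₚ -ₚ q ^ₚ 2 *ₚ x) ^ₚ 3 +ₚ κ q *ₚ (oneₚ -ₚ q *ₚ x ^ₚ 2) *ₚ x ^ₚ 3)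
gosper = solve 2 (λ q x → :h q (q :^ 2 :* x) :* (con 1ℤ :- q :* x) :* (q :- x) :^ 3
  := q :^ 3 :* :h q x :* (con 1ℤ :- x) :* (con 1ℤ :- q :^ 2 :* x) :^ 3
    :+ (q :^ 2 :* (con 1ℤ :- q) :^ 4 :* (q :^ 3 :- con 1ℤ) :^ 3) :* (con 1ℤ :- q :* x :^ 2) :* x :^ 3) ≋-refl

-- The antidifference vanishes at k = 0 through its factor 1 - x, so only the upper end of the
-- telescoping sum remains.
gosperNum gosperDen : ℕ → Poly
gosperNum K = h qₚ (q² ^ₚ suc K) *ₚ O (suc K) *ₚ A (suc K) ^ₚ 3
gosperDen K = (oneₚ -ₚ qₚ) *ₚ κ qₚ *ₚ termDen K

termDen≉0 : ∀ k → ¬ termDen k ≋ []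
termDen≉0 k = ≉0-* (^≉0 3 (^≉0 k q≉0)) (≉0-* (^≉0 3 (E₄≉0 k)) (E₂≉0 k))

q²^k : ∀ k → (q² ^ₚ k) ≋ ((qₚ ^ₚ k) ^ₚ 2)
q²^k k = ≋-trans (≋-sym (^-* qₚ k 2)) (≋-trans (≋-reflexive (≡.cong (qₚ ^ₚ_) (ℕP.*-comm k 2))) (^-* qₚ 2 k))

qint-4k+1 : ∀ k → (qint (4 ℕ.* k ℕ.+ 1) *ₚ (oneₚ -ₚ qₚ)) ≋ (oneₚ -ₚ qₚ *ₚ (q² ^ₚ k) ^ₚ 2)
qint-4k+1 k = begin
  i *ₚ (oneₚ -ₚ qₚ)                       ≈⟨ solve 2 (λ i q → i :* (con 1ℤ :- q) := :- (i :* (q :* con 1ℤ :- con 1ℤ))) ≋-refl i qₚ ⟩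
  -ₚ (i *ₚ qpow-1 1)                      ≈⟨ neg-cong (qint-* (4 ℕ.* k ℕ.+ 1)) ⟩
  -ₚ qpow-1 (4 ℕ.* k ℕ.+ 1)               ≈⟨ neg-cong (+-cong (≋-trans (^-+ qₚ (4 ℕ.* k) 1) (*-cong (^-* qₚ 4 k) ≋-refl)) (≋-refl { -ₚ oneₚ})) ⟩
  -ₚ (y ^ₚ 4 *ₚ qₚ ^ₚ 1 -ₚ oneₚ)          ≈⟨ solve 2 (λ y q → :- (y :^ 4 :* q :^ 1 :- con 1ℤ) := con 1ℤ :- q :* (y :^ 2) :^ 2) ≋-refl y qₚ ⟩
  oneₚ -ₚ qₚ *ₚ (y ^ₚ 2) ^ₚ 2             ≈⟨ +-cong (≋-refl {oneₚ}) (neg-cong (*-congˡ qₚ (^-cong 2 (q²^k k)))) ⟨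
  oneₚ -ₚ qₚ *ₚ (q² ^ₚ k) ^ₚ 2            ∎
  where
  open ≋R
  i = qint (4 ℕ.* k ℕ.+ 1)
  y = qₚ ^ₚ k

q^6k : ∀ k → (qₚ ^ₚ (6 ℕ.* k)) ≋ ((q² ^ₚ k) ^ₚ 3)
q^6k k = ≋-trans (^-* qₚ 6 k) (≋-trans (solve 1 (λ y → y :^ 6 := (y :^ 2) :^ 3) ≋-refl (qₚ ^ₚ k)) (^-cong 3 (≋-sym (q²^k k))))

-- Written in the `x` of the next index, so that it agrees with the coefficient of `h q x` in
-- `gosper`.
growth : ℕ → Poly
growth K = qₚ ^ₚ 3 *ₚ (oneₚ -ₚ x) *ₚ (oneₚ -ₚ q² *ₚ x) ^ₚ 3
  where x = q² ^ₚ suc K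

termDen-suc : ∀ K → termDen (suc K) ≋ (termDen K *ₚ growth K)
termDen-suc K = solve 5 (λ q y x e f →
  (q :* y) :^ 3 :* ((e :* (con 1ℤ :- q :^ 4 :* x)) :^ 3 :* (f :* (con 1ℤ :- q :^ 2 :* x)))
  := y :^ 3 :* (e :^ 3 :* f) :* (q :^ 3 :* (con 1ℤ :- q :^ 2 :* x) :* (con 1ℤ :- q :^ 2 :* (q :^ 2 :* x)) :^ 3))
  ≋-refl qₚ (qₚ ^ₚ K) (q² ^ₚ K) (E₄ K) (E₂ K)

gosperNum-suc : ∀ K → (gosperNum K *ₚ growth K +ₚ termNum (suc K) *ₚ ((oneₚ -ₚ qₚ) *ₚ κ qₚ)) ≋ gosperNum (suc K)
gosperNum-suc K = begin
  h₁ *ₚ o *ₚ a ^ₚ 3 *ₚ growth K +ₚ i *ₚ (a ^ₚ 3 *ₚ o *ₚ t) *ₚ ((oneₚ -ₚ qₚ) *ₚ c)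
    ≈⟨ solve 8 (λ h o a g i t p c → h :* o :* a :^ 3 :* g :+ i :* (a :^ 3 :* o :* t) :* (p :* c) := o :* a :^ 3 :* (h :* g :+ c :* (i :* p) :* t)) ≋-refl h₁ o a (growth K) i t (oneₚ -ₚ qₚ) c ⟩
  o *ₚ a ^ₚ 3 *ₚ (h₁ *ₚ growth K +ₚ c *ₚ (i *ₚ (oneₚ -ₚ qₚ)) *ₚ t)
    ≈⟨ *-congˡ (o *ₚ a ^ₚ 3) (+-cong (solve 4 (λ h q₃ u v → h :* (q₃ :* u :* v) := q₃ :* h :* u :* v) ≋-refl h₁ (qₚ ^ₚ 3) (oneₚ -ₚ x) ((oneₚ -ₚ q² *ₚ x) ^ₚ 3))
         (*-cong (*-congˡ c (qint-4k+1 (suc K))) (q^6k (suc K)))) ⟩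
  o *ₚ a ^ₚ 3 *ₚ (qₚ ^ₚ 3 *ₚ h₁ *ₚ (oneₚ -ₚ x) *ₚ (oneₚ -ₚ q² *ₚ x) ^ₚ 3 +ₚ c *ₚ (oneₚ -ₚ qₚ *ₚ x ^ₚ 2) *ₚ x ^ₚ 3)
    ≈⟨ *-congˡ (o *ₚ a ^ₚ 3) (gosper qₚ x) ⟨
  o *ₚ a ^ₚ 3 *ₚ (h₂ *ₚ (oneₚ -ₚ qₚ *ₚ x) *ₚ (qₚ -ₚ x) ^ₚ 3)
    ≈⟨ solve 5 (λ h o a q x → o :* a :^ 3 :* (h :* (con 1ℤ :- q :* x) :* (q :- x) :^ 3) := h :* (o :* (con 1ℤ :- q :* x)) :* (a :* (q :- con 1ℤ :* x)) :^ 3) ≋-refl h₂ o a qₚ x ⟩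
  h₂ *ₚ (o *ₚ (oneₚ -ₚ qₚ *ₚ x)) *ₚ (a *ₚ (qₚ -ₚ oneₚ *ₚ x)) ^ₚ 3 ∎
  where
  open ≋R
  x = q² ^ₚ suc K
  h₁ = h qₚ x
  h₂ = h qₚ (q² ^ₚ suc (suc K))
  o = O (suc K)
  a = A (suc K)
  i = qint (4 ℕ.* suc K ℕ.+ 1)
  t = qₚ ^ₚ (6 ℕ.* suc K)
  c = κ qₚ

≃-sumTerms : ∀ K → sumTerms K ≃ gosperNum K / gosperDen K
≃-sumTerms zero = ≃-resp
  (begin
    (oneₚ -ₚ qₚ) *ₚ κ qₚ *ₚ termNum 0
      -- At x = 1 the factor 1 - x kills the first summand of `gosper`, which therefore evaluates
      -- the term k = 0.
      ≈⟨ solve 2 (λ q c → (con 1ℤ :- q) :* c :* (con 1ℤ :* (con 1ℤ :^ 3 :* con 1ℤ :* con 1ℤ)) := q :^ 3 :* :h q (con 1ℤ) :* (con 1ℤ :- con 1ℤ) :* (con 1ℤ :- q :^ 2 :* con 1ℤ) :^ 3 :+ c :* (con 1ℤ :- q :* con 1ℤ :^ 2) :* con 1ℤ :^ 3) ≋-refl qₚ (κ qₚ) ⟩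
    qₚ ^ₚ 3 *ₚ h qₚ oneₚ *ₚ (oneₚ -ₚ oneₚ) *ₚ (oneₚ -ₚ qₚ ^ₚ 2 *ₚ oneₚ) ^ₚ 3 +ₚ κ qₚ *ₚ (oneₚ -ₚ qₚ *ₚ oneₚ ^ₚ 2) *ₚ oneₚ ^ₚ 3
      ≈⟨ gosper qₚ oneₚ ⟨
    h qₚ (q² *ₚ oneₚ) *ₚ (oneₚ -ₚ qₚ *ₚ oneₚ) *ₚ (qₚ -ₚ oneₚ) ^ₚ 3
      ≈⟨ solve 2 (λ h q → h :* (con 1ℤ :- q :* con 1ℤ) :* (q :- con 1ℤ) :^ 3 := h :* (con 1ℤ :* (con 1ℤ :- q :* con 1ℤ)) :* (con 1ℤ :* (q :- con 1ℤ :* con 1ℤ)) :^ 3) ≋-refl (h qₚ (q² *ₚ oneₚ)) qₚ ⟩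
    gosperNum 0 ∎)
  ≋-refl
  (≃-scale ((oneₚ -ₚ qₚ) *ₚ κ qₚ) (≃-term 0))
  where open ≋R
-- `fadd` multiplies the denominators, but `termDen K` divides `termDen (suc K)` and cancels.
≃-sumTerms (suc K) = ≃-cancel d (termDen≉0 K) (≃-resp
  (begin
    gosperNum K *ₚ termDen (suc K) +ₚ termNum (suc K) *ₚ (g *ₚ d)     ≈⟨ +-cong (*-congˡ (gosperNum K) (termDen-suc K)) ≋-refl ⟩
    gosperNum K *ₚ (d *ₚ growth K) +ₚ termNum (suc K) *ₚ (g *ₚ d)     ≈⟨ solve 5 (λ n d r t g → n :* (d :* r) :+ t :* (g :* d) := d :* (n :* r :+ t :* g)) ≋-refl (gosperNum K) d (growth K) (termNum (suc K)) g ⟩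
    d *ₚ (gosperNum K *ₚ growth K +ₚ termNum (suc K) *ₚ g)            ≈⟨ *-congˡ d (gosperNum-suc K) ⟩
    d *ₚ gosperNum (suc K)                                            ∎)
  (solve 3 (λ g d e → g :* d :* e := d :* (g :* e)) ≋-refl g d (termDen (suc K)))
  (≃-fadd (≃-sumTerms K) (≃-term (suc K))))
  where
  open ≋R
  d = termDen K
  g = (oneₚ -ₚ qₚ) *ₚ κ qₚ

-- Gaussian binomial coefficients

-- The product (q;q)_k, without division by (1 - q)^k.
qFactorial : ℕ → Poly
qFactorial zero    = oneₚ
qFactorial (suc k) = qFactorial k *ₚ (oneₚ -ₚ qₚ ^ₚ suc k)

-- The Gaussian binomial of a + b over a, by the q-Pascal rule, which makes it a polynomial by
-- construction.
gaussian : ℕ → ℕ → Poly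
gaussian zero    b       = oneₚ
gaussian (suc a) zero    = oneₚ
gaussian (suc a) (suc b) = gaussian a (suc b) +ₚ qₚ ^ₚ suc a *ₚ gaussian (suc a) b

qFactorial-+ : ∀ a b → qFactorial (a ℕ.+ b) ≋ (qFactorial a *ₚ qFactorial b *ₚ gaussian a b)
qFactorial-+ zero    b    = solve 1 (λ x → x := con 1ℤ :* x :* con 1ℤ) ≋-refl (qFactorial b)
qFactorial-+ (suc a) zero = ≋-trans (≋-reflexive (≡.cong (λ i → qFactorial (suc i)) (ℕP.+-identityʳ a)))
  (solve 1 (λ x → x := x :* con 1ℤ :* con 1ℤ) ≋-refl (qFactorial (suc a)))
qFactorial-+ (suc a) (suc b) = begin
  F (a ℕ.+ suc b) *ₚ (oneₚ -ₚ qₚ ^ₚ (suc a ℕ.+ suc b))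
    ≈⟨ *-congˡ (F (a ℕ.+ suc b)) (+-cong (≋-refl {oneₚ}) (neg-cong (^-+ qₚ (suc a) (suc b)))) ⟩
  F (a ℕ.+ suc b) *ₚ (oneₚ -ₚ x *ₚ y)
    -- The splitting 1 - xy = (1 - x) + x(1 - y) mirrors the two summands of the q-Pascal rule.
    ≈⟨ solve 3 (λ f x y → f :* (con 1ℤ :- x :* y) := f :* (con 1ℤ :- x) :+ f :* (x :* (con 1ℤ :- y))) ≋-refl (F (a ℕ.+ suc b)) x y ⟩
  F (a ℕ.+ suc b) *ₚ (oneₚ -ₚ x) +ₚ F (a ℕ.+ suc b) *ₚ (x *ₚ (oneₚ -ₚ y))
    ≈⟨ +-cong (*-cong (qFactorial-+ a (suc b)) ≋-refl) (*-cong (≋-trans (≋-reflexive (≡.cong F (ℕP.+-suc a b))) (qFactorial-+ (suc a) b)) ≋-refl) ⟩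
  F a *ₚ (F b *ₚ (oneₚ -ₚ y)) *ₚ gaussian a (suc b) *ₚ (oneₚ -ₚ x) +ₚ F a *ₚ (oneₚ -ₚ x) *ₚ F b *ₚ gaussian (suc a) b *ₚ (x *ₚ (oneₚ -ₚ y))
    ≈⟨ solve 6 (λ f g u v x y → f :* (g :* (con 1ℤ :- y)) :* u :* (con 1ℤ :- x) :+ f :* (con 1ℤ :- x) :* g :* v :* (x :* (con 1ℤ :- y))
         := f :* (con 1ℤ :- x) :* (g :* (con 1ℤ :- y)) :* (u :+ x :* v)) ≋-refl (F a) (F b) (gaussian a (suc b)) (gaussian (suc a) b) x y ⟩
  F (suc a) *ₚ F (suc b) *ₚ gaussian (suc a) (suc b) ∎
  where
  open ≋R
  F = qFactorial
  x = qₚ ^ₚ suc a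
  y = qₚ ^ₚ suc b

-- The product (-q;q)_k.
V : ℕ → Poly
V zero    = oneₚ
V (suc k) = V k *ₚ (oneₚ +ₚ qₚ ^ₚ suc k)

qFactorial*V : ∀ k → (qFactorial k *ₚ V k) ≋ E₂ k
qFactorial*V zero    = *-identityˡ oneₚ
qFactorial*V (suc k) = begin
  qFactorial k *ₚ (oneₚ -ₚ y) *ₚ (V k *ₚ (oneₚ +ₚ y))      ≈⟨ solve 4 (λ f v q z → f :* (con 1ℤ :- q :* z) :* (v :* (con 1ℤ :+ q :* z)) := f :* v :* (con 1ℤ :- q :^ 2 :* z :^ 2)) ≋-refl (qFactorial k) (V k) qₚ (qₚ ^ₚ k) ⟩
  qFactorial k *ₚ V k *ₚ (oneₚ -ₚ q² *ₚ (qₚ ^ₚ k) ^ₚ 2)    ≈⟨ *-cong (qFactorial*V k) (+-cong (≋-refl {oneₚ}) (neg-cong (*-congˡ q² (≋-sym (q²^k k))))) ⟩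
  E₂ (suc k)                                               ∎
  where
  open ≋R
  y = qₚ ^ₚ suc k

qFactorial-double : ∀ k → qFactorial (k ℕ.+ k) ≋ (O k *ₚ E₂ k)
qFactorial-double zero    = ≋-sym (*-identityˡ oneₚ)
qFactorial-double (suc k) = begin
  F (k ℕ.+ suc k) *ₚ (oneₚ -ₚ qₚ ^ₚ suc (k ℕ.+ suc k))                      ≡⟨ ≡.cong (λ i → F i *ₚ (oneₚ -ₚ qₚ ^ₚ suc i)) (ℕP.+-suc k k) ⟩
  F (k ℕ.+ k) *ₚ (oneₚ -ₚ qₚ *ₚ z) *ₚ (oneₚ -ₚ qₚ *ₚ (qₚ *ₚ z))             ≈⟨ *-cong (*-cong (qFactorial-double k) (≋-refl {oneₚ -ₚ qₚ *ₚ z})) (≋-refl {oneₚ -ₚ qₚ *ₚ (qₚ *ₚ z)}) ⟩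
  O k *ₚ E₂ k *ₚ (oneₚ -ₚ qₚ *ₚ z) *ₚ (oneₚ -ₚ qₚ *ₚ (qₚ *ₚ z))             ≈⟨ *-cong (*-congˡ (O k *ₚ E₂ k) (+-cong (≋-refl {oneₚ}) (neg-cong (*-congˡ qₚ z≋)))) (+-cong (≋-refl {oneₚ}) (neg-cong (*-congˡ qₚ (*-congˡ qₚ z≋)))) ⟩
  O k *ₚ E₂ k *ₚ (oneₚ -ₚ qₚ *ₚ x) *ₚ (oneₚ -ₚ qₚ *ₚ (qₚ *ₚ x))             ≈⟨ solve 4 (λ o e q x → o :* e :* (con 1ℤ :- q :* x) :* (con 1ℤ :- q :* (q :* x)) := o :* (con 1ℤ :- q :* x) :* (e :* (con 1ℤ :- q :^ 2 :* x))) ≋-refl (O k) (E₂ k) qₚ x ⟩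
  O (suc k) *ₚ E₂ (suc k)                                                   ∎
  where
  open ≋R
  F = qFactorial
  z = qₚ ^ₚ (k ℕ.+ k)
  x = q² ^ₚ k
  z≋ : z ≋ x
  z≋ = ≋-trans (^-+ qₚ k k) (≋-trans (solve 1 (λ y → y :* y := y :^ 2) ≋-refl (qₚ ^ₚ k)) (≋-sym (q²^k k)))

-- Two evaluations of (q;q)_(2k) are compared: by parity of the exponents it is `O k *ₚ E₂ k`, by
-- the binomial it is (q;q)_k² `gaussian k k`. The factor `V k ^ₚ 2` completes (q;q)_k² to
-- `E₂ k ^ₚ 2`.
O*V² : ∀ k → (O k *ₚ V k ^ₚ 2) ≋ (E₂ k *ₚ gaussian k k)
O*V² k = *-cancelˡ (E₂ k) (E₂≉0 k) (begin
  E₂ k *ₚ (O k *ₚ V k ^ₚ 2)                            ≈⟨ solve 3 (λ e o v → e :* (o :* v :^ 2) := o :* e :* v :^ 2) ≋-refl (E₂ k) (O k) (V k) ⟩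
  O k *ₚ E₂ k *ₚ V k ^ₚ 2                              ≈⟨ *-cong (≋-trans (≋-sym (qFactorial-double k)) (qFactorial-+ k k)) (≋-refl {V k ^ₚ 2}) ⟩
  f *ₚ f *ₚ gaussian k k *ₚ V k ^ₚ 2                   ≈⟨ solve 3 (λ f g v → f :* f :* g :* v :^ 2 := (f :* v) :* ((f :* v) :* g)) ≋-refl f (gaussian k k) (V k) ⟩
  (f *ₚ V k) *ₚ ((f *ₚ V k) *ₚ gaussian k k)           ≈⟨ *-cong (qFactorial*V k) (*-cong (qFactorial*V k) ≋-refl) ⟩
  E₂ k *ₚ (E₂ k *ₚ gaussian k k)                       ∎)
  where
  open ≋R
  f = qFactorial k

-- Splitting off the first factor of (q^-1;q²)_(k+1) leaves (q;q²)_k.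
A-suc : ∀ k → A (suc k) ≋ ((qₚ -ₚ oneₚ) *ₚ qₚ ^ₚ k *ₚ O k)
A-suc zero    = solve 1 (λ q → con 1ℤ :* (q :- con 1ℤ :* con 1ℤ) := (q :- con 1ℤ) :* con 1ℤ :* con 1ℤ) ≋-refl qₚ
A-suc (suc k) = ≋-trans (*-cong (A-suc k) (≋-refl {qₚ -ₚ oneₚ *ₚ q² ^ₚ suc k}))
  (solve 4 (λ q y o x → (q :- con 1ℤ) :* y :* o :* (q :- con 1ℤ :* (q :^ 2 :* x)) := (q :- con 1ℤ) :* (q :* y) :* (o :* (con 1ℤ :- q :* x)))
    ≋-refl qₚ (qₚ ^ₚ k) (O k) (q² ^ₚ k))

E₄*[1-q²] : ∀ k → (E₄ k *ₚ (oneₚ -ₚ q²)) ≋ E₂ (suc k)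
E₄*[1-q²] zero    = solve 1 (λ x → con 1ℤ :* (con 1ℤ :- x) := con 1ℤ :* (con 1ℤ :- x :* con 1ℤ)) ≋-refl q²
E₄*[1-q²] (suc k) = begin
  E₄ k *ₚ (oneₚ -ₚ qₚ ^ₚ 4 *ₚ x) *ₚ (oneₚ -ₚ q²)      ≈⟨ solve 3 (λ e q x → e :* (con 1ℤ :- q :^ 4 :* x) :* (con 1ℤ :- q :^ 2) := e :* (con 1ℤ :- q :^ 2) :* (con 1ℤ :- q :^ 2 :* (q :^ 2 :* x))) ≋-refl (E₄ k) qₚ x ⟩
  E₄ k *ₚ (oneₚ -ₚ q²) *ₚ (oneₚ -ₚ q² *ₚ (q² *ₚ x))   ≈⟨ *-cong (E₄*[1-q²] k) ≋-refl ⟩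
  E₂ (suc (suc k))                                    ∎
  where
  open ≋R
  x = q² ^ₚ k

-- The sum with all factors common to numerator and denominator removed

module _ (m : ℕ) where
  private
    x y H B v c : Poly
    -- For n = 2m + 1 this is q^(n-1), so 1 - qx, 1 - q²x and 1 - q⁴x are 1 - q^n, 1 - q^(n+1) and 1
    -- - q^(n+3).
    x = q² ^ₚ m
    y = qₚ ^ₚ suc m
    H = h qₚ (q² ^ₚ suc (suc m))
    B = gaussian m m
    v = V m
    c = κ qₚ

  reducedCofactor reducedNum reducedDen : Poly
  reducedCofactor = H *ₚ (oneₚ -ₚ qₚ ^ₚ 3 *ₚ x) *ₚ (qₚ -ₚ oneₚ) ^ₚ 3 *ₚ B ^ₚ 4 *ₚ (oneₚ -ₚ q²) ^ₚ 3
  reducedNum = reducedCofactor *ₚ (oneₚ -ₚ qₚ *ₚ x) ^ₚ 4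
  reducedDen = (oneₚ -ₚ qₚ) *ₚ c *ₚ (oneₚ -ₚ q² *ₚ x) ^ₚ 4 *ₚ (oneₚ -ₚ qₚ ^ₚ 4 *ₚ x) ^ₚ 3 *ₚ v ^ₚ 8

  -- Extending by (1 - q²)³ completes the three `E₄` to `E₂`, and extending by v⁸ turns the four
  -- `O m` into `E₂ m` times the binomial; then `E₂ m ^ₚ 4` cancels.
  ≃-reduced : sumTerms (suc m) ≃ reducedNum / reducedDen
  ≃-reduced = ≃-cancel (y ^ₚ 3 *ₚ E₂ m ^ₚ 4) (≉0-* (^≉0 3 (^≉0 (suc m) q≉0)) (^≉0 4 (E₂≉0 m)))
    (≃-resp numerator denominator (≃-scale ((oneₚ -ₚ q²) ^ₚ 3 *ₚ v ^ₚ 8) (≃-sumTerms (suc m))))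
    where
    open ≋R
    numerator : ((oneₚ -ₚ q²) ^ₚ 3 *ₚ v ^ₚ 8 *ₚ gosperNum (suc m)) ≋ (y ^ₚ 3 *ₚ E₂ m ^ₚ 4 *ₚ reducedNum)
    numerator = begin
      (oneₚ -ₚ q²) ^ₚ 3 *ₚ v ^ₚ 8 *ₚ (H *ₚ O (suc (suc m)) *ₚ A (suc (suc m)) ^ₚ 3)
        ≈⟨ *-congˡ ((oneₚ -ₚ q²) ^ₚ 3 *ₚ v ^ₚ 8) (*-congˡ (H *ₚ O (suc (suc m))) (^-cong 3 (A-suc (suc m)))) ⟩
      (oneₚ -ₚ q²) ^ₚ 3 *ₚ v ^ₚ 8 *ₚ (H *ₚ O (suc (suc m)) *ₚ ((qₚ -ₚ oneₚ) *ₚ y *ₚ O (suc m)) ^ₚ 3)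
        ≈⟨ solve 6 (λ q v h o x y → (con 1ℤ :- q :^ 2) :^ 3 :* v :^ 8 :* (h :* (o :* (con 1ℤ :- q :* x) :* (con 1ℤ :- q :* (q :^ 2 :* x))) :* ((q :- con 1ℤ) :* y :* (o :* (con 1ℤ :- q :* x))) :^ 3)
             := (o :* v :^ 2) :^ 4 :* (y :^ 3 :* (h :* (con 1ℤ :- q :^ 3 :* x) :* (q :- con 1ℤ) :^ 3 :* (con 1ℤ :- q :^ 2) :^ 3 :* (con 1ℤ :- q :* x) :^ 4)))
             ≋-refl qₚ v H (O m) x y ⟩
      (O m *ₚ v ^ₚ 2) ^ₚ 4 *ₚ (y ^ₚ 3 *ₚ (H *ₚ (oneₚ -ₚ qₚ ^ₚ 3 *ₚ x) *ₚ (qₚ -ₚ oneₚ) ^ₚ 3 *ₚ (oneₚ -ₚ q²) ^ₚ 3 *ₚ (oneₚ -ₚ qₚ *ₚ x) ^ₚ 4))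
        ≈⟨ *-cong (^-cong 4 (O*V² m)) ≋-refl ⟩
      (E₂ m *ₚ B) ^ₚ 4 *ₚ (y ^ₚ 3 *ₚ (H *ₚ (oneₚ -ₚ qₚ ^ₚ 3 *ₚ x) *ₚ (qₚ -ₚ oneₚ) ^ₚ 3 *ₚ (oneₚ -ₚ q²) ^ₚ 3 *ₚ (oneₚ -ₚ qₚ *ₚ x) ^ₚ 4))
        ≈⟨ solve 8 (λ e b y h s t u w → (e :* b) :^ 4 :* (y :^ 3 :* (h :* s :* t :* u :* w)) := y :^ 3 :* e :^ 4 :* (h :* s :* t :* b :^ 4 :* u :* w))
             ≋-refl (E₂ m) B y H (oneₚ -ₚ qₚ ^ₚ 3 *ₚ x) ((qₚ -ₚ oneₚ) ^ₚ 3) ((oneₚ -ₚ q²) ^ₚ 3) ((oneₚ -ₚ qₚ *ₚ x) ^ₚ 4) ⟩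
      y ^ₚ 3 *ₚ E₂ m ^ₚ 4 *ₚ reducedNum ∎
    denominator : ((oneₚ -ₚ q²) ^ₚ 3 *ₚ v ^ₚ 8 *ₚ gosperDen (suc m)) ≋ (y ^ₚ 3 *ₚ E₂ m ^ₚ 4 *ₚ reducedDen)
    denominator = begin
      (oneₚ -ₚ q²) ^ₚ 3 *ₚ v ^ₚ 8 *ₚ ((oneₚ -ₚ qₚ) *ₚ c *ₚ (y ^ₚ 3 *ₚ (E₄ (suc m) ^ₚ 3 *ₚ E₂ (suc m))))
        ≈⟨ solve 7 (λ r v p c y e f → r :^ 3 :* v :^ 8 :* (p :* c :* (y :^ 3 :* (e :^ 3 :* f))) := p :* c :* y :^ 3 :* v :^ 8 :* ((e :* r) :^ 3 :* f))
             ≋-refl (oneₚ -ₚ q²) v (oneₚ -ₚ qₚ) c y (E₄ (suc m)) (E₂ (suc m)) ⟩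
      (oneₚ -ₚ qₚ) *ₚ c *ₚ y ^ₚ 3 *ₚ v ^ₚ 8 *ₚ ((E₄ (suc m) *ₚ (oneₚ -ₚ q²)) ^ₚ 3 *ₚ E₂ (suc m))
        ≈⟨ *-congˡ ((oneₚ -ₚ qₚ) *ₚ c *ₚ y ^ₚ 3 *ₚ v ^ₚ 8) (*-cong (^-cong 3 (E₄*[1-q²] (suc m))) (≋-refl {E₂ (suc m)})) ⟩
      (oneₚ -ₚ qₚ) *ₚ c *ₚ y ^ₚ 3 *ₚ v ^ₚ 8 *ₚ (E₂ (suc (suc m)) ^ₚ 3 *ₚ E₂ (suc m))
        ≈⟨ solve 6 (λ q c y v e x → (con 1ℤ :- q) :* c :* y :^ 3 :* v :^ 8 :* ((e :* (con 1ℤ :- q :^ 2 :* x) :* (con 1ℤ :- q :^ 2 :* (q :^ 2 :* x))) :^ 3 :* (e :* (con 1ℤ :- q :^ 2 :* x)))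
             := y :^ 3 :* e :^ 4 :* ((con 1ℤ :- q) :* c :* (con 1ℤ :- q :^ 2 :* x) :^ 4 :* (con 1ℤ :- q :^ 4 :* x) :^ 3 :* v :^ 8))
             ≋-refl qₚ c y v (E₂ m) x ⟩
      y ^ₚ 3 *ₚ E₂ m ^ₚ 4 *ₚ reducedDen ∎

-- Comaximality with the denominator

comaximal-+ : ∀ {f g h k} → f ∣ h → (h +ₚ g) ≋ k → Comaximal f g → Comaximal f k
comaximal-+ {f} {g} {h} {k} (M , m) e = comaximal-combine {a = -ₚ M} {oneₚ} (begin
  (-ₚ M) *ₚ f +ₚ oneₚ *ₚ k        ≈⟨ +-cong (solve 2 (λ M f → (:- M) :* f := :- (M :* f)) ≋-refl M f) (*-congˡ oneₚ (≋-sym e)) ⟩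
  -ₚ (M *ₚ f) +ₚ oneₚ *ₚ (h +ₚ g) ≈⟨ +-cong (neg-cong m) ≋-refl ⟩
  -ₚ h +ₚ oneₚ *ₚ (h +ₚ g)        ≈⟨ solve 2 (λ h g → :- h :+ con 1ℤ :* (h :+ g) := g) ≋-refl h g ⟩
  g                               ∎)
  where open ≋R

comaximal-neg : ∀ {f g k} → (-ₚ g) ≋ k → Comaximal f g → Comaximal f k
comaximal-neg {f} {g} {k} e = comaximal-∣ʳ (-ₚ oneₚ , ≋-trans (*-congˡ (-ₚ oneₚ) (≋-sym e))
  (solve 1 (λ g → :- con 1ℤ :* (:- g) := g) ≋-refl g))

qpow-1-comaximal-q : ∀ n → Comaximal (qpow-1 (suc n)) qₚ
qpow-1-comaximal-q n = comaximal {u = -ₚ oneₚ} {qₚ ^ₚ n} {1ℤ} 1≢0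
  (solve 2 (λ q y → :- con 1ℤ :* (q :* y :- con 1ℤ) :+ y :* q := con 1ℤ) ≋-refl qₚ (qₚ ^ₚ n))

neg-^-odd : ∀ y m → ((-ₚ y) ^ₚ suc (m ℕ.* 2)) ≋ (-ₚ (y ^ₚ suc (m ℕ.* 2)))
neg-^-odd y zero    = solve 1 (λ y → :- y :* con 1ℤ := :- (y :* con 1ℤ)) ≋-refl y
neg-^-odd y (suc m) = ≋-trans (*-congˡ (-ₚ y) (*-congˡ (-ₚ y) (neg-^-odd y m)))
  (solve 2 (λ y z → :- y :* (:- y :* :- z) := :- (y :* (y :* z))) ≋-refl y (y ^ₚ suc (m ℕ.* 2)))

-- For odd n, 1 + q^j divides 1 + q^(jn), and the latter is 2 modulo q^n - 1.
qpow-1-comaximal-1+q^ : ∀ m j → Comaximal (qpow-1 (suc (m ℕ.* 2))) (oneₚ +ₚ qₚ ^ₚ j)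
qpow-1-comaximal-1+q^ m j = comaximal {u = -ₚ g} {g′} {+ 2} (λ ()) (begin
  (-ₚ g) *ₚ qpow-1 n +ₚ g′ *ₚ (oneₚ +ₚ y)
    ≈⟨ solve 4 (λ g x g′ y → (:- g) :* x :+ g′ :* (con 1ℤ :+ y) := :- (g :* x) :- g′ :* (:- y :- con 1ℤ)) ≋-refl g (qpow-1 n) g′ y ⟩
  -ₚ (g *ₚ qpow-1 n) -ₚ g′ *ₚ (-ₚ y -ₚ oneₚ)
    ≈⟨ +-cong (neg-cong (≋-trans (qpow-1-* j n) (+-cong (≋-trans (≋-reflexive (≡.cong (qₚ ^ₚ_) (ℕP.*-comm j n))) (^-* qₚ n j)) (≋-refl { -ₚ oneₚ}))))
         (neg-cong (≋-trans (geometric-* (-ₚ y) n) (+-cong (neg-^-odd y m) (≋-refl { -ₚ oneₚ})))) ⟩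
  -ₚ (y ^ₚ n -ₚ oneₚ) -ₚ (-ₚ (y ^ₚ n) -ₚ oneₚ)
    ≈⟨ solve 1 (λ z → :- (z :- con 1ℤ) :- (:- z :- con 1ℤ) := con (+ 2)) ≋-refl (y ^ₚ n) ⟩
  constₚ (+ 2) ∎)
  where
  open ≋R
  n = suc (m ℕ.* 2)
  y = qₚ ^ₚ j
  g = geometric (qₚ ^ₚ n) j
  g′ = geometric (-ₚ y) n

qpow-1-comaximal-V : ∀ m k → Comaximal (qpow-1 (suc (m ℕ.* 2))) (V k)
qpow-1-comaximal-V m zero    = comaximal-1ʳ
qpow-1-comaximal-V m (suc k) = comaximal-*ʳ (qpow-1-comaximal-V m k) (qpow-1-comaximal-1+q^ m (suc k))

q²^m : ∀ m → (q² ^ₚ m) ≋ (qₚ ^ₚ (m ℕ.* 2))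
q²^m m = ≋-sym (^-* qₚ m 2)

-- Stated for an arbitrary divisor `f` of q^n - 1 so that it serves both `Φ n` and [n].
comaximal-reducedDen : ∀ {f} m → f ∣ qpow-1 (suc (m ℕ.* 2)) → Comaximal f (qpow-1 1) → Comaximal f (qpow-1 3) →
  Comaximal f (reducedDen m)
comaximal-reducedDen {f} m f∣ f⊥1 f⊥3 =
  comaximal-*ʳ (comaximal-*ʳ (comaximal-*ʳ (comaximal-*ʳ ⊥1-q
    (comaximal-*ʳ (comaximal-*ʳ (comaximal-^ʳ 2 ⊥q) (comaximal-^ʳ 4 ⊥1-q)) (comaximal-^ʳ 3 f⊥3)))
    (comaximal-^ʳ 4 ⊥1-q²x)) (comaximal-^ʳ 3 ⊥1-q⁴x)) (comaximal-^ʳ 8 (comaximal-∣ˡ f∣ (qpow-1-comaximal-V m m)))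
  where
  n = suc (m ℕ.* 2)
  x = q² ^ₚ m
  ⊥q : Comaximal f qₚ
  ⊥q = comaximal-∣ˡ f∣ (qpow-1-comaximal-q (m ℕ.* 2))
  ⊥qx : Comaximal f (qₚ *ₚ x)
  ⊥qx = comaximal-*ʳ ⊥q (comaximal-^ʳ m (comaximal-^ʳ 2 ⊥q))
  ⊥1-q : Comaximal f (oneₚ -ₚ qₚ)
  ⊥1-q = comaximal-neg (solve 1 (λ q → :- (q :* con 1ℤ :- con 1ℤ) := con 1ℤ :- q) ≋-refl qₚ) f⊥1
  qpow≋ : qpow-1 n ≋ (qₚ *ₚ x -ₚ oneₚ)
  qpow≋ = +-cong (*-congˡ qₚ (≋-sym (q²^m m))) (≋-refl { -ₚ oneₚ})
  ⊥1-q²x : Comaximal f (oneₚ -ₚ q² *ₚ x)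
  -- q^(n+1) - 1 = (q^n - 1) + q^n (q - 1), where `f` divides the first summand and is comaximal
  -- with the second.
  ⊥1-q²x = comaximal-neg (solve 2 (λ q x → :- ((q :* x :- con 1ℤ) :+ (q :* x) :* (q :^ 1 :- con 1ℤ)) := con 1ℤ :- q :^ 2 :* x) ≋-refl qₚ x)
    (comaximal-+ f∣ (+-cong qpow≋ (≋-refl {qₚ *ₚ x *ₚ qpow-1 1})) (comaximal-*ʳ ⊥qx f⊥1))
  ⊥1-q⁴x : Comaximal f (oneₚ -ₚ qₚ ^ₚ 4 *ₚ x)
  ⊥1-q⁴x = comaximal-neg (solve 2 (λ q x → :- ((q :* x :- con 1ℤ) :+ (q :* x) :* (q :^ 3 :- con 1ℤ)) := con 1ℤ :- q :^ 4 :* x) ≋-refl qₚ x)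
    (comaximal-+ f∣ (+-cong qpow≋ (≋-refl {qₚ *ₚ x *ₚ qpow-1 3})) (comaximal-*ʳ ⊥qx f⊥3))

-- Divisibility of the numerator and both congruences for n = 2m + 1

qint-∣-1-qx : ∀ m → qint (suc (m ℕ.* 2)) ∣ (oneₚ -ₚ qₚ *ₚ q² ^ₚ m)
qint-∣-1-qx m = ∣-≋ (begin
    (-ₚ oneₚ) *ₚ qpow-1 n            ≈⟨ *-congˡ (-ₚ oneₚ) (+-cong (*-congˡ qₚ (≋-sym (q²^m m))) (≋-refl { -ₚ oneₚ})) ⟩
    (-ₚ oneₚ) *ₚ (qₚ *ₚ x -ₚ oneₚ)   ≈⟨ solve 1 (λ z → (:- con 1ℤ) :* (z :- con 1ℤ) := con 1ℤ :- z) ≋-refl (qₚ *ₚ x) ⟩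
    oneₚ -ₚ qₚ *ₚ x                  ∎)
  (∣-*ˡ (-ₚ oneₚ) (qint∣qpow-1 n))
  where
  open ≋R
  n = suc (m ℕ.* 2)
  x = q² ^ₚ m

∣-^ : ∀ {p r} k → p ∣ r → (p ^ₚ k) ∣ (r ^ₚ k)
∣-^ zero    d = ∣-refl
∣-^ (suc k) d = ∣-* d (∣-^ k d)

-- As `Φ n` divides [n], this single divisibility covers both moduli.
qint³∣reducedNum : ∀ m → (qint (suc (m ℕ.* 2)) ^ₚ 3) ∣ reducedNum m
qint³∣reducedNum m = ∣-*ˡ (reducedCofactor m) (∣-*ˡ (oneₚ -ₚ qₚ *ₚ q² ^ₚ m) (∣-^ 3 (qint-∣-1-qx m)))

supercongruence : ∀ m → 2 ℕ.≤ m → let n = suc (m ℕ.* 2) in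
  (sumTerms (suc m) ≡ fzero [mod Φ n ^ₚ 3 ])
  × (gcd n 3 ≡ 1 → sumTerms (suc m) ≡ fzero [mod qint n *ₚ (Φ n ^ₚ 2) ])
supercongruence m@(suc m-1) 2≤m =
  ≡0[mod] den≉0 (≃-reduced m) (∣-trans (∣-^ 3 Φ∣) (qint³∣reducedNum m)) (comaximal-^ˡ 3 Φ⊥) ,
  λ coprime → ≡0[mod] den≉0 (≃-reduced m) (∣-trans (∣-* (∣-refl {qint n}) (∣-^ 2 Φ∣)) (qint³∣reducedNum m))
    (comaximal-*ˡ (comaximal-reducedDen m (qint∣qpow-1 n) (qint-comaximal-q-1 (m ℕ.* 2)) (qint-comaximal-qpow-1 (m ℕ.* 2) 3 coprime))
      (comaximal-^ˡ 2 Φ⊥))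
  where
  n = suc (m ℕ.* 2)
  den≉0 = den-sumTerms≉0 (suc m)
  -- Here n > 3 enters: `Φ-comaximal-qpow-1` requires the exponent 3 to be smaller than the index n.
  3≤n-1 : 3 ℕ.≤ m ℕ.* 2
  3≤n-1 = ℕP.≤-trans (ℕP.n≤1+n 3) (ℕP.*-monoˡ-≤ 2 2≤m)
  Φ∣ : Φ n ∣ qint n
  Φ∣ = Φ∣qint (suc (m-1 ℕ.* 2))
  Φ⊥ : Comaximal (Φ n) (reducedDen m)
  Φ⊥ = comaximal-reducedDen m (∣-trans Φ∣ (qint∣qpow-1 n))
    (Φ-comaximal-qpow-1 (cyclotomicUpTo n) (s≤s z≤n)) (Φ-comaximal-qpow-1 (cyclotomicUpTo n) 3≤n-1)

theorem5p7 : (n : ℕ) → 3 < n → n % 2 ≡ 1 →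
    (sumTerms ((n + 1) / 2) ≡ fzero [mod Φ n ^ₚ 3 ])
    × (gcd n 3 ≡ 1 → sumTerms ((n + 1) / 2) ≡ fzero [mod qint n *ₚ (Φ n ^ₚ 2) ])
theorem5p7 n 3<n odd = ≡.subst₂
  (λ N K → (sumTerms K ≡ fzero [mod Φ N ^ₚ 3 ]) × (gcd N 3 ≡ 1 → sumTerms K ≡ fzero [mod qint N *ₚ (Φ N ^ₚ 2) ]))
  (≡.sym n≡) (≡.sym K≡) (supercongruence m 2≤m)
  where
  m = n / 2
  n≡ : n ≡ suc (m ℕ.* 2)
  n≡ = ≡.trans (m≡m%n+[m/n]*n n 2) (≡.cong (_+ m ℕ.* 2) odd)
  K≡ : (n + 1) / 2 ≡ suc m
  K≡ = ≡.trans (≡.cong (_/ 2) (≡.trans (ℕP.+-comm n 1) (≡.cong suc n≡))) (m*n/n≡m (suc m) 2)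
  2≤m : 2 ℕ.≤ m
  -- `3 < n` unfolds to `4 ≤ n`, and `4 / 2` computes to 2.
  2≤m = /-monoˡ-≤ 2 3<n
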